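{- Let $k\ge 2$ be an integer and let $n$ be an integer with $n\ge k+\lfloor\sqrt{k-1}\rfloor+2$. If $G$ is a $(C_4,K_{1,k})$-co-critical graph on $n$ vertices, then \[ e(G)\ge \frac{(k+2)n}{2}-3-\frac{(k-1)(k+\lfloor\sqrt{k-2}\rfloor)}{2}. \]
   Context: All graphs are finite, simple, without loops or multiple edges; $e(G)$ denotes the number of edges of $G$. For a graph $G$, a $\{\text{red},\text{blue}\}$-coloring of $E(G)$ is a critical coloring if $G$ contains neither a red copy of $C_4$ (the cycle on 4 vertices, as a not necessarily induced subgraph) nor a blue copy of $K_{1,k}$ (the star with $k$ leaves). A non-complete graph $G$ is $(C_4,K_{1,k})$-co-critical if $G$ admits a critical coloring, but for every edge $e$ of the complement of $G$, the graph $G+e$ (obtained by adding $e$) admits no critical coloring. -}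

module Defs where

open import Data.Nat using (ℕ; zero; suc; _+_; _*_; _∸_; _≤_; _<_)
open import Data.Fin using (Fin; _≟_) renaming (_<_ to _<ᶠ_)
open import Data.Fin.Properties using () renaming (_<?_ to _<ᶠ?_)
open import Data.Bool using (Bool; true; false; _∧_; _∨_; if_then_else_)
open import Data.List using (List; map)
open import Data.Nat.ListAction using (sum)
open import Data.List using () renaming (allFin to allFinL)
open import Data.Product using (Σ; ∃; _×_; _,_)
open import Relation.Nullary using (¬_)
open import Relation.Nullary.Decidable using (⌊_⌋)
open import Relation.Binary.PropositionalEquality using (_≡_; _≢_)
open import Function.Definitions using (Injective)

Graph : ℕ → Set
Graph n = Fin n → Fin n → Bool

record IsSimple {n : ℕ} (G : Graph n) : Set where
  field
    sym     : ∀ i j → G i j ≡ G j i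
    irrefl  : ∀ i → G i i ≡ false

e : {n : ℕ} → Graph n → ℕ
e {n} G = sum (map (λ i → sum (map (λ j →
            if ⌊ i <ᶠ? j ⌋ ∧ G i j then 1 else 0) (allFinL n))) (allFinL n))

addEdge : {n : ℕ} → Graph n → Fin n → Fin n → Graph n
addEdge G u v i j =
  G i j ∨ (⌊ i ≟ u ⌋ ∧ ⌊ j ≟ v ⌋) ∨ (⌊ i ≟ v ⌋ ∧ ⌊ j ≟ u ⌋)

-- an edge colouring: true = red, false = blue (only values on edges matter)
Coloring : ℕ → Set
Coloring n = Fin n → Fin n → Bool

red : Bool
red = true

blue : Bool
blue = false

RedEdge : {n : ℕ} → Graph n → Coloring n → Fin n → Fin n → Set
RedEdge G c x y = (G x y ≡ true) × (c x y ≡ red)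

RedC4 : {n : ℕ} → Graph n → Coloring n → Set
RedC4 {n} G c = Σ (Fin n) λ a → Σ (Fin n) λ b → Σ (Fin n) λ x → Σ (Fin n) λ d →
  (a ≢ b) × (a ≢ x) × (a ≢ d) × (b ≢ x) × (b ≢ d) × (x ≢ d) ×
  RedEdge G c a b × RedEdge G c b x × RedEdge G c x d × RedEdge G c d a

BlueStar : {n : ℕ} → ℕ → Graph n → Coloring n → Set
BlueStar {n} k G c = Σ (Fin n) λ v → Σ (Fin k → Fin n) λ f →
  Injective _≡_ _≡_ f ×
  (∀ i → (f i ≢ v) × (G v (f i) ≡ true) × (c v (f i) ≡ blue))

record Critical {n : ℕ} (k : ℕ) (G : Graph n) (c : Coloring n) : Set where
  field
    csym   : ∀ i j → c i j ≡ c j i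
    noC4   : ¬ RedC4 G c
    noStar : ¬ BlueStar k G c

HasCritical : {n : ℕ} → ℕ → Graph n → Set
HasCritical {n} k G = Σ (Coloring n) λ c → Critical k G c

NonComplete : {n : ℕ} → Graph n → Set
NonComplete {n} G = Σ (Fin n) λ u → Σ (Fin n) λ v → (u ≢ v) × (G u v ≡ false)

record CoCritical {n : ℕ} (k : ℕ) (G : Graph n) : Set where
  field
    simple      : IsSimple G
    noncomplete : NonComplete G
    critical    : HasCritical k G
    saturated   : ∀ u v → u ≢ v → G u v ≡ false → ¬ HasCritical k (addEdge G u v)

IsFloorSqrt : ℕ → ℕ → Set
IsFloorSqrt m s = (s * s ≤ m) × (m < suc s * suc s)

{-# OPTIONS --safe #-}
module Submission where

-- Take a critical colouring with as many red edges as possible.  Then recolouring a blue edge red creates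
-- a red C₄, and so does adding a red edge, hence the red graph is C₄-saturated; by Ollmann's theorem it has
-- degree sum at least 3n − 6.  Two non-adjacent vertices cannot both have blue degree below k − 1, since
-- they could be joined by a blue edge, so the vertices of small blue degree form a clique.  Counting red
-- paths of length two in this clique shows that it has at most k + s vertices, or k + s + 1 vertices all
-- of blue degree k − 2.
--
-- For Ollmann's theorem, take a breadth-first tree from a vertex v of degree at most two: a leaf if there
-- is one, otherwise a vertex outside all triangles if possible; with minimum degree three the bound is
-- clear.  The tree has depth at most three, its edges contribute 2n − 2 to the degree sum, and all but four
-- vertices can be charged to distinct ends of non-tree edges.

open import Defs
import Algebra.Properties.Semiring.Sum as SemiringSum
open import Data.Bool using (Bool; true; false; _∧_; _∨_; not; if_then_else_)
open import Data.Bool.Properties using (∧-conicalˡ; ∧-conicalʳ; ∨-zeroʳ; ¬-not) renaming (_≟_ to _≟ᵇ_)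
open import Data.Empty using (⊥; ⊥-elim)
open import Data.Fin using (Fin; zero; suc; _≟_)
open import Data.Fin.Patterns using (0F; 1F; 2F; 3F)
open import Data.Fin.Properties using (any?; all?; toℕ-injective)
  renaming (_<?_ to _<ᶠ?_; suc-injective to Fin-suc-injective)
import Data.List as List
open import Data.List.Properties using (map-tabulate)
import Data.Nat.ListAction as ListAction
open import Data.Nat using (ℕ; zero; suc; _+_; _*_; _∸_; _⊓_; _≤_; _<_; z≤n; s≤s; _≤?_)
  renaming (_≟_ to _≟ᴺ_)
open import Data.Nat.Properties hiding (_≟_)
open import Data.Nat.Tactic.RingSolver using (solve-∀)
open import Data.Product using (∃; _×_; _,_; proj₁)
open import Data.Sum using (_⊎_; inj₁; inj₂; [_,_]′)
open import Data.Vec using (Vec; []; _∷_; lookup)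
open import Data.Vec.Relation.Unary.All using (All; []; _∷_)
open import Data.Vec.Relation.Unary.All.Properties using (lookup⁺)
open import Data.Vec.Relation.Unary.AllPairs using ([]; _∷_)
open import Data.Vec.Relation.Unary.Unique.Propositional using (Unique)
open import Data.Vec.Relation.Unary.Unique.Propositional.Properties using (lookup-injective)
open import Function using (_∘_)
open import Function.Definitions using (Injective)
open import Relation.Binary.PropositionalEquality
open import Relation.Nullary using (¬_; Dec; yes; no; does; contradiction)
open import Relation.Nullary.Decidable
  using (⌊_⌋; _×-dec_; _⊎-dec_; _→-dec_; ¬?; decidable-stable; dec-true; dec-false)

open SemiringSum +-*-semiring
  using (sum; sum-syntax; sum-cong-≗; ∑-distrib-+; ∑-comm; *-distribˡ-sum; *-distribʳ-sum)

private variable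
  n k : ℕ

-- Finite sums and counting.

⟦_⟧ : Bool → ℕ
⟦ b ⟧ = if b then 1 else 0

⟦⟧≤1 : ∀ b → ⟦ b ⟧ ≤ 1
⟦⟧≤1 true  = ≤-refl
⟦⟧≤1 false = z≤n

count : (Fin n → Bool) → ℕ
count P = sum (λ i → ⟦ P i ⟧)

sum-mono : {f g : Fin n → ℕ} → (∀ i → f i ≤ g i) → sum f ≤ sum g
sum-mono {zero}  f≤g = z≤n
sum-mono {suc n} f≤g = +-mono-≤ (f≤g zero) (sum-mono (f≤g ∘ suc))

sum-mono-< : {f g : Fin n → ℕ} → (∀ i → f i ≤ g i) → ∀ i → f i < g i → sum f < sum g
sum-mono-< f≤g zero    lt = +-mono-<-≤ lt (sum-mono (f≤g ∘ suc))
sum-mono-< f≤g (suc i) lt = +-mono-≤-< (f≤g zero) (sum-mono-< (f≤g ∘ suc) i lt)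

sum-const : ∀ n c → sum {n} (λ _ → c) ≡ n * c
sum-const zero    c = refl
sum-const (suc n) c = cong (c +_) (sum-const n c)

sum-zero : ∀ n → sum {n} (λ _ → 0) ≡ 0
sum-zero n = trans (sum-const n 0) (*-zeroʳ n)

sum-one : ∀ n → sum {n} (λ _ → 1) ≡ n
sum-one n = trans (sum-const n 1) (*-identityʳ n)

term≤sum : (f : Fin n → ℕ) (i : Fin n) → f i ≤ sum f
term≤sum f zero    = m≤m+n _ _
term≤sum f (suc i) = ≤-trans (term≤sum (f ∘ suc) i) (m≤n+m _ _)

δ : Fin n → Fin n → ℕ
δ i j = ⟦ does (i ≟ j) ⟧

sum-δ : (i : Fin n) (g : Fin n → ℕ) → ∑[ j < n ] (δ i j * g j) ≡ g i
sum-δ {suc n} zero    g = trans (cong₂ _+_ (+-identityʳ _) (sum-zero n)) (+-identityʳ _)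
sum-δ {suc n} (suc i) g = sum-δ i (g ∘ suc)

sum-δ₁ : (i : Fin n) → sum (δ i) ≡ 1
sum-δ₁ i = trans (sum-cong-≗ (λ j → sym (*-identityʳ (δ i j)))) (sum-δ i (λ _ → 1))

δ-refl : (i : Fin n) → δ i i ≡ 1
δ-refl i = cong ⟦_⟧ (dec-true (i ≟ i) refl)

count≤1 : (P : Fin n → Bool) → (∀ i j → P i ≡ true → P j ≡ true → i ≡ j) → count P ≤ 1
count≤1 {zero}  P unique = z≤n
count≤1 {suc n} P unique with P zero in eq
... | false = count≤1 (P ∘ suc) λ i j p q →
   Fin-suc-injective (unique (suc i) (suc j) p q)
... | true  = s≤s (≤-trans (sum-mono rest≤0) (≤-reflexive (sum-zero n)))
  where
  rest≤0 : ∀ i → ⟦ P (suc i) ⟧ ≤ 0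
  rest≤0 i with P (suc i) in eqᵢ
  ... | false = z≤n
  ... | true with () ← unique zero (suc i) eq eqᵢ

dec-sound : {A : Set} (a? : Dec A) → does a? ≡ true → A
dec-sound (yes a) _ = a

-- Double counting of the pairs (i, f i): injectivity leaves at most one `i` over each value, and
-- none over a value outside `P`.
injection⇒≤count : (P : Fin n → Bool) (f : Fin k → Fin n) → Injective _≡_ _≡_ f →
                   (∀ i → P (f i) ≡ true) → k ≤ count P
injection⇒≤count {n} {k} P f f-inj Pf = begin
  k                                     ≡⟨ sum-one k ⟨
  ∑[ i < k ] 1                          ≡⟨ sum-cong-≗ (λ i → sum-δ₁ (f i)) ⟨
  ∑[ i < k ] ∑[ j < n ] δ (f i) j       ≡⟨ ∑-comm (λ i j → δ (f i) j) ⟩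
  ∑[ j < n ] ∑[ i < k ] δ (f i) j       ≤⟨ sum-mono fibre ⟩
  count P                               ∎
  where
  open ≤-Reasoning
  fibre : ∀ j → ∑[ i < k ] δ (f i) j ≤ ⟦ P j ⟧
  fibre j with P j in eq
  ... | true  = count≤1 _ λ i i′ p q →
    f-inj (trans (dec-sound (f i ≟ j) p) (sym (dec-sound (f i′ ≟ j) q)))
  ... | false = ≤-trans (sum-mono none) (≤-reflexive (sum-zero k))
    where
    none : ∀ i → δ (f i) j ≤ 0
    none i with f i ≟ j
    ... | no _ = z≤n
    ... | yes refl with () ← trans (sym eq) (Pf i)

unique⇒≤count : (P : Fin n → Bool) {xs : Vec (Fin n) k} → Unique xs → All (λ x → P x ≡ true) xs → k ≤ count P
unique⇒≤count P {xs} uxs pxs = injection⇒≤count P (lookup xs) (lookup-injective uxs _ _) (lookup⁺ pxs)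

-- C₄-free and C₄-saturated graphs.

infix 4 _⊢_∼_

_⊢_∼_ : Graph n → Fin n → Fin n → Set
R ⊢ x ∼ y = R x y ≡ true

degree : Graph n → Fin n → ℕ
degree R u = count (R u)

-- Only the two diagonals are required to be distinct; in a loopless graph adjacency separates the
-- other four pairs.
C4Free : Graph n → Set
C4Free R = ∀ {a b x d} → a ≢ x → b ≢ d → R ⊢ a ∼ b → R ⊢ b ∼ x → R ⊢ x ∼ d → R ⊢ d ∼ a → ⊥

-- For distinct ends in a simple graph, these are the three-edge paths that an edge between the ends
-- closes to a C₄.
Path₃ : Graph n → Fin n → Fin n → Set
Path₃ R u v = ∃ λ x → ∃ λ y → u ≢ y × x ≢ v × R ⊢ u ∼ x × R ⊢ x ∼ y × R ⊢ y ∼ v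

adjacent? : (R : Graph n) → ∀ x y → Dec (R ⊢ x ∼ y)
adjacent? R x y = R x y ≟ᵇ true

path₃? : (R : Graph n) → ∀ u v → Dec (Path₃ R u v)
path₃? R u v = any? λ x → any? λ y → ¬? (u ≟ y) ×-dec ¬? (x ≟ v) ×-dec
  adjacent? R u x ×-dec adjacent? R x y ×-dec adjacent? R y v

DegreeTwoInTriangles : Graph n → Set
DegreeTwoInTriangles R = ∀ t y z → (∀ j → R ⊢ t ∼ j → j ≡ y ⊎ j ≡ z) →
  R ⊢ t ∼ y → R ⊢ t ∼ z → y ≢ z → R ⊢ y ∼ z

record C4Saturated (R : Graph n) : Set where
  field
    simple    : IsSimple R
    c4free    : C4Free R
    saturated : ∀ u v → u ≢ v → ¬ R ⊢ u ∼ v → Path₃ R u v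

  open IsSimple simple public renaming (sym to R-sym; irrefl to R-irrefl)

  ∼-sym : ∀ {x y} → R ⊢ x ∼ y → R ⊢ y ∼ x
  ∼-sym {x} {y} p = trans (R-sym y x) p

  ∼⇒≢ : ∀ {x y} → R ⊢ x ∼ y → x ≢ y
  ∼⇒≢ {x} p refl with () ← trans (sym p) (R-irrefl x)

-- The breadth-first tree from a vertex.

module Tree {n} {R : Graph n} (R-sat : C4Saturated R) (v : Fin n) where
  open C4Saturated R-sat

  infix 4 _∼_
  _∼_ : Fin n → Fin n → Set
  x ∼ y = R ⊢ x ∼ y

  Near : Fin n → Set
  Near u = ∃ λ y → v ∼ y × y ∼ u

  -- Saturation joins `v` to each non-neighbour by three edges, so no depth exceeds three. Each
  -- constructor keeps the witness from which the parent is read off.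
  data Position (u : Fin n) : Set where
    root  : u ≡ v → Position u
    one   : v ∼ u → Position u
    two   : u ≢ v → ¬ v ∼ u → Near u → Position u
    three : u ≢ v → ¬ v ∼ u → ¬ Near u → (∃ λ x → Near x × x ∼ u) → Position u

  position : ∀ u → Position u
  position u with u ≟ v
  ... | yes u≡v = root u≡v
  ... | no  u≢v with adjacent? R v u
  ...   | yes v∼u = one v∼u
  ...   | no  v≁u with any? (λ y → adjacent? R v y ×-dec adjacent? R y u)
  ...     | yes near = two u≢v v≁u near
  ...     | no ¬near = three u≢v v≁u ¬near (far (saturated v u (u≢v ∘ sym) v≁u))
    where
    far : Path₃ R v u → ∃ λ x → Near x × x ∼ u
    far (y , x , _ , _ , v∼y , y∼x , x∼u) = x , (y , v∼y , y∼x) , x∼u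

  depth : ∀ {u} → Position u → ℕ
  depth (root _)        = 0
  depth (one _)         = 1
  depth (two _ _ _)     = 2
  depth (three _ _ _ _) = 3

  up : ∀ {u} → Position u → Fin n
  up (root _)                  = v
  up (one _)                   = v
  up (two _ _ (y , _))         = y
  up (three _ _ _ (x , _ , _)) = x

  ℓ : Fin n → ℕ
  ℓ u = depth (position u)

  -- The root is its own parent.
  p : Fin n → Fin n
  p u = up (position u)

  ℓ≤3 : ∀ u → ℓ u ≤ 3
  ℓ≤3 u with position u
  ... | root _        = z≤n
  ... | one _         = s≤s z≤n
  ... | two _ _ _     = s≤s (s≤s z≤n)
  ... | three _ _ _ _ = ≤-refl

  ℓ≡0⇒root : ∀ {u} → ℓ u ≡ 0 → u ≡ v
  ℓ≡0⇒root {u} eq with position u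
  ... | root u≡v = u≡v

  ℓ≡1⇒∼ : ∀ {u} → ℓ u ≡ 1 → v ∼ u
  ℓ≡1⇒∼ {u} eq with position u
  ... | one v∼u = v∼u

  p-root : p v ≡ v
  p-root with position v
  ... | root _          = refl
  ... | one _           = refl
  ... | two v≢v _ _     = contradiction refl v≢v
  ... | three v≢v _ _ _ = contradiction refl v≢v

  ℓ-root : ℓ v ≡ 0
  ℓ-root with position v
  ... | root _          = refl
  ... | one v∼v         = contradiction refl (∼⇒≢ v∼v)
  ... | two v≢v _ _     = contradiction refl v≢v
  ... | three v≢v _ _ _ = contradiction refl v≢v

  ∼⇒ℓ≡1 : ∀ {u} → v ∼ u → ℓ u ≡ 1
  ∼⇒ℓ≡1 {u} v∼u with position u
  ... | root refl       = contradiction refl (∼⇒≢ v∼u)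
  ... | one _           = refl
  ... | two _ v≁u _     = contradiction v∼u v≁u
  ... | three _ v≁u _ _ = contradiction v∼u v≁u

  near⇒ℓ≡2 : ∀ {u} → u ≢ v → ¬ v ∼ u → Near u → ℓ u ≡ 2
  near⇒ℓ≡2 {u} u≢v v≁u near with position u
  ... | root u≡v          = contradiction u≡v u≢v
  ... | one v∼u           = contradiction v∼u v≁u
  ... | two _ _ _         = refl
  ... | three _ _ ¬near _ = contradiction near ¬near

  near⇒ℓ≤2 : ∀ {u} → Near u → ℓ u ≤ 2
  near⇒ℓ≤2 {u} near with position u
  ... | root _            = z≤n
  ... | one _             = s≤s z≤n
  ... | two _ _ _         = ≤-refl
  ... | three _ _ ¬near _ = contradiction near ¬near

  ℓ-lipschitz : ∀ {w u} → w ∼ u → ℓ u ≤ suc (ℓ w)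
  ℓ-lipschitz {w} {u} w∼u with position w
  ... | root refl       = ≤-reflexive (∼⇒ℓ≡1 w∼u)
  ... | one v∼w         = near⇒ℓ≤2 (w , v∼w , w∼u)
  ... | two _ _ _       = ℓ≤3 u
  ... | three _ _ _ _   = ≤-trans (ℓ≤3 u) (n≤1+n 3)

  ∼p : ∀ {u} → u ≢ v → u ∼ p u
  ∼p {u} u≢v with position u
  ... | root u≡v                   = contradiction u≡v u≢v
  ... | one v∼u                    = ∼-sym v∼u
  ... | two _ _ (y , _ , y∼u)      = ∼-sym y∼u
  ... | three _ _ _ (x , _ , x∼u)  = ∼-sym x∼u

  ℓ-p : ∀ {u} → u ≢ v → suc (ℓ (p u)) ≡ ℓ u
  ℓ-p {u} u≢v with position u
  ... | root u≡v                = contradiction u≡v u≢v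
  ... | one _                   = cong suc ℓ-root
  ... | two _ _ (y , v∼y , _)   = cong suc (∼⇒ℓ≡1 v∼y)
  ... | three _ v≁u ¬near (x , near , x∼u) = cong suc (near⇒ℓ≡2 x≢v v≁x near)
    where
    x≢v : x ≢ v
    x≢v refl = v≁u x∼u
    v≁x : ¬ v ∼ x
    v≁x v∼x = ¬near (x , v∼x , x∼u)

  ℓ≡suc⇒≢root : ∀ {u m} → ℓ u ≡ suc m → u ≢ v
  ℓ≡suc⇒≢root eq refl with () ← trans (sym eq) ℓ-root

  ℓ-parent : ∀ {u m} → ℓ u ≡ suc m → ℓ (p u) ≡ m
  ℓ-parent eq = suc-injective (trans (ℓ-p (ℓ≡suc⇒≢root eq)) eq)

  -- Two neighbours of `u` at level one would form a C₄ with `v` and `u`.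
  parent-unique : ∀ {u w} → ℓ u ≡ 2 → ℓ w ≡ 1 → w ∼ u → w ≡ p u
  parent-unique {u} {w} ℓu ℓw w∼u = decidable-stable (w ≟ p u) λ w≢pu →
    c4free (λ v≡u → ℓ≡suc⇒≢root ℓu (sym v≡u)) w≢pu
      (ℓ≡1⇒∼ ℓw) w∼u (∼p (ℓ≡suc⇒≢root ℓu)) (∼-sym (ℓ≡1⇒∼ (ℓ-parent ℓu)))

  -- Non-tree edges and the charging of vertices to their ends.

  nontree : Fin n → Fin n → Bool
  nontree u j = R u j ∧ not (does (p u ≟ j)) ∧ not (does (p j ≟ u))

  nd : Fin n → ℕ
  nd u = count (nontree u)

  nontree⁺ : ∀ {u j} → u ∼ j → p u ≢ j → p j ≢ u → nontree u j ≡ true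
  nontree⁺ {u} {j} u∼j pu≢j pj≢u
    rewrite u∼j | dec-false (p u ≟ j) pu≢j | dec-false (p j ≟ u) pj≢u = refl

  nd≥1 : ∀ {u j} → nontree u j ≡ true → 1 ≤ nd u
  nd≥1 {u} nt = unique⇒≤count (nontree u) ([] ∷ []) (nt ∷ [])

  -- The factor discards the root, whose parent is itself, so that every other vertex contributes
  -- one arc, towards its parent.
  tree : Fin n → Fin n → ℕ
  tree u j = ⟦ not (does (v ≟ u)) ⟧ * δ (p u) j

  -- Each step to a parent lowers the depth by one, so two steps cannot return to `u`.
  p-acyclic : ∀ {u j} → u ≢ v → p u ≡ j → j ≢ v → p j ≢ u
  p-acyclic {u} u≢v refl pu≢v eq = m≢1+n+m (ℓ u)
    (sym (trans (cong (2 +_) (cong ℓ (sym eq))) (trans (cong suc (ℓ-p pu≢v)) (ℓ-p u≢v))))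

  tree-dichotomy : ∀ u j → tree u j ≡ 0 ⊎ (tree u j ≡ 1 × u ≢ v × p u ≡ j)
  tree-dichotomy u j with v ≟ u
  ... | yes _ = inj₁ refl
  ... | no v≢u with p u ≟ j
  ...   | yes pu≡j = inj₂ (refl , v≢u ∘ sym , pu≡j)
  ...   | no _     = inj₁ refl

  -- The three summands exclude one another, and each needs an edge between `u` and `j`.
  edge-split : ∀ u j → tree u j + tree j u + ⟦ nontree u j ⟧ ≤ ⟦ R u j ⟧
  edge-split u j with tree-dichotomy u j | tree-dichotomy j u
  ... | inj₁ eq | inj₁ eq′ rewrite eq | eq′ with R u j
  ...   | true  = ⟦⟧≤1 _
  ...   | false = z≤n
  edge-split u _ | inj₂ (eq , u≢v , refl) | inj₁ eq′
    rewrite eq | eq′ | ∼p u≢v | dec-true (p u ≟ p u) refl = ≤-refl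
  edge-split _ j | inj₁ eq | inj₂ (eq′ , j≢v , refl)
    rewrite eq | eq′ | ∼-sym (∼p j≢v) | dec-true (p j ≟ p j) refl
    with does (p (p j) ≟ j)
  ... | true  = ≤-refl
  ... | false = ≤-refl
  edge-split u j | inj₂ (_ , u≢v , pu≡j) | inj₂ (_ , j≢v , pj≡u) =
    contradiction pj≡u (p-acyclic u≢v pu≡j j≢v)

  tree-row : ∀ u → sum (tree u) + δ v u ≡ 1
  tree-row u = trans (cong (_+ δ v u) row) (complement (does (v ≟ u)))
    where
    row : sum (tree u) ≡ ⟦ not (does (v ≟ u)) ⟧
    row = trans (sym (*-distribˡ-sum ⟦ not (does (v ≟ u)) ⟧ (δ (p u))))
      (trans (cong (⟦ not (does (v ≟ u)) ⟧ *_) (sum-δ₁ (p u))) (*-identityʳ _))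
    complement : ∀ b → ⟦ not b ⟧ + ⟦ b ⟧ ≡ 1
    complement true  = refl
    complement false = refl

  tree-total : ∑[ u < n ] sum (tree u) + 1 ≡ n
  tree-total = begin
    ∑[ u < n ] sum (tree u) + 1              ≡⟨ cong (∑[ u < n ] sum (tree u) +_) (sum-δ₁ v) ⟨
    ∑[ u < n ] sum (tree u) + sum (δ v)      ≡⟨ ∑-distrib-+ (λ u → sum (tree u)) (δ v) ⟨
    ∑[ u < n ] (sum (tree u) + δ v u)        ≡⟨ sum-cong-≗ tree-row ⟩
    ∑[ u < n ] 1                             ≡⟨ sum-one n ⟩
    n                                        ∎
    where open ≡-Reasoning

  -- The n - 1 tree edges are counted once from each end; this accounts for the 2 on the right.
  2n+∑nd≤∑degree+2 : n + n + sum nd ≤ sum (degree R) + 2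
  2n+∑nd≤∑degree+2 = begin
    n + n + sum nd                 ≡⟨ cong (λ m → m + m + sum nd) tree-total ⟨
    (T + 1) + (T + 1) + sum nd     ≡⟨ regroup T (sum nd) ⟩
    (T + T + sum nd) + 2           ≤⟨ +-monoˡ-≤ 2 T+T+nd≤ ⟩
    sum (degree R) + 2             ∎
    where
    open ≤-Reasoning
    T : ℕ
    T = ∑[ u < n ] sum (tree u)
    regroup : ∀ t m → (t + 1) + (t + 1) + m ≡ (t + t + m) + 2
    regroup = solve-∀
    T+T+nd≤ : T + T + sum nd ≤ sum (degree R)
    T+T+nd≤ = begin
      T + T + sum nd
        ≡⟨ cong (λ t → T + t + sum nd) (∑-comm tree) ⟩
      T + ∑[ u < n ] ∑[ j < n ] tree j u + sum nd
        ≡⟨ cong (_+ sum nd) (∑-distrib-+ (λ u → sum (tree u)) (λ u → ∑[ j < n ] tree j u)) ⟨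
      ∑[ u < n ] (sum (tree u) + ∑[ j < n ] tree j u) + sum nd
        ≡⟨ ∑-distrib-+ (λ u → sum (tree u) + ∑[ j < n ] tree j u) nd ⟨
      ∑[ u < n ] (sum (tree u) + ∑[ j < n ] tree j u + nd u)
        ≤⟨ sum-mono row ⟩
      sum (degree R) ∎
      where
      row : ∀ u → sum (tree u) + ∑[ j < n ] tree j u + nd u ≤ degree R u
      row u = begin
        sum (tree u) + ∑[ j < n ] tree j u + nd u
          ≡⟨ cong (_+ nd u) (∑-distrib-+ (tree u) (λ j → tree j u)) ⟨
        ∑[ j < n ] (tree u j + tree j u) + nd u
          ≡⟨ ∑-distrib-+ (λ j → tree u j + tree j u) (λ j → ⟦ nontree u j ⟧) ⟨
        ∑[ j < n ] (tree u j + tree j u + ⟦ nontree u j ⟧)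
          ≤⟨ sum-mono (edge-split u) ⟩
        degree R u ∎

  -- A vertex may be excepted, may own an end of a non-tree edge, or may receive a surplus end from
  -- a child. A vertex has one parent, so its surplus is passed to one place only.
  Covered : ∀ {c} → (Fin c → Fin n) → Fin n → Set
  Covered exc u = (∃ λ i → exc i ≡ u) ⊎ 1 ≤ nd u ⊎ (∃ λ t → p t ≡ u × 2 ≤ nd t)

  -- Splits nd u = (nd u ⊓ 1) + (nd u ∸ 1) and moves the second part to the parent of u.
  n≤c+∑nd : ∀ {c} (exc : Fin c → Fin n) → (∀ u → Covered exc u) → n ≤ c + sum nd
  n≤c+∑nd {c} exc covered = begin
    n                                             ≡⟨ sum-one n ⟨
    ∑[ u < n ] 1                                  ≤⟨ sum-mono share ⟩
    ∑[ u < n ] (hits u + own u + gift u)          ≡⟨ ∑-distrib-+ (λ u → hits u + own u) gift ⟩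
    ∑[ u < n ] (hits u + own u) + sum gift        ≡⟨ cong (_+ sum gift) (∑-distrib-+ hits own) ⟩
    sum hits + sum own + sum gift                 ≡⟨ +-assoc (sum hits) (sum own) (sum gift) ⟩
    sum hits + (sum own + sum gift)               ≡⟨ cong₂ (λ a b → a + (sum own + b)) hits-total gift-total ⟩
    c + (sum own + ∑[ t < n ] (nd t ∸ 1))         ≡⟨ cong (c +_) (∑-distrib-+ own (λ t → nd t ∸ 1)) ⟨
    c + ∑[ t < n ] (own t + (nd t ∸ 1))           ≡⟨ cong (c +_) (sum-cong-≗ (λ t → m⊓n+n∸m≡n 1 (nd t))) ⟩
    c + sum nd                                    ∎
    where
    open ≤-Reasoning
    hits own gift : Fin n → ℕ
    hits u = ∑[ i < c ] δ (exc i) u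
    own u  = 1 ⊓ nd u
    gift u = ∑[ t < n ] (δ (p t) u * (nd t ∸ 1))
    hits-total : sum hits ≡ c
    hits-total = trans (∑-comm (λ u i → δ (exc i) u))
      (trans (sum-cong-≗ (λ i → sum-δ₁ (exc i))) (sum-one c))
    gift-total : sum gift ≡ ∑[ t < n ] (nd t ∸ 1)
    gift-total = trans (∑-comm (λ u t → δ (p t) u * (nd t ∸ 1)))
      (sum-cong-≗ (λ t → sum-δ (p t) (λ _ → nd t ∸ 1)))
    share : ∀ u → 1 ≤ hits u + own u + gift u
    share u with covered u
    ... | inj₁ (i , refl) = ≤-trans (≤-reflexive (sym (δ-refl (exc i))))
      (≤-trans (term≤sum (λ i′ → δ (exc i′) (exc i)) i) (≤-trans (m≤m+n _ _) (m≤m+n _ _)))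
    ... | inj₂ (inj₁ 1≤nd) = ≤-trans (⊓-glb ≤-refl 1≤nd) (≤-trans (m≤n+m _ (hits u)) (m≤m+n _ _))
    ... | inj₂ (inj₂ (t , refl , 2≤nd)) = begin
      1                                  ≤⟨ ∸-monoˡ-≤ 1 2≤nd ⟩
      nd t ∸ 1                           ≡⟨ +-identityʳ _ ⟨
      1 * (nd t ∸ 1)                     ≡⟨ cong (_* (nd t ∸ 1)) (δ-refl (p t)) ⟨
      δ (p t) (p t) * (nd t ∸ 1)         ≤⟨ term≤sum (λ t′ → δ (p t′) (p t) * (nd t′ ∸ 1)) t ⟩
      gift (p t)                         ≤⟨ m≤n+m _ _ ⟩
      hits (p t) + own (p t) + gift (p t) ∎

  -- The 6 consists of the four exceptions and the 2 by which 2n - 2 falls short of 2n.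
  3n≤∑degree+6 : (exc : Fin 4 → Fin n) → (∀ u → Covered exc u) → 3 * n ≤ sum (degree R) + 6
  3n≤∑degree+6 exc covered = begin
    3 * n                        ≡⟨ triple n ⟩
    n + (n + n)                  ≤⟨ +-monoˡ-≤ (n + n) (n≤c+∑nd exc covered) ⟩
    4 + sum nd + (n + n)         ≡⟨ regroup (sum nd) (n + n) ⟩
    4 + (n + n + sum nd)         ≤⟨ +-monoʳ-≤ 4 2n+∑nd≤∑degree+2 ⟩
    4 + (sum (degree R) + 2)     ≡⟨ collect (sum (degree R)) ⟩
    sum (degree R) + 6           ∎
    where
    open ≤-Reasoning
    triple : ∀ m → 3 * m ≡ m + (m + m)
    triple = solve-∀
    regroup : ∀ a b → 4 + a + b ≡ 4 + (b + a)
    regroup = solve-∀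
    collect : ∀ a → 4 + (a + 2) ≡ a + 6
    collect = solve-∀

  -- Non-tree edges at each level.

  ≢-by-ℓ : ∀ {x y a b} → ℓ x ≡ a → ℓ y ≡ b → a ≢ b → x ≢ y
  ≢-by-ℓ ℓx ℓy a≢b refl = a≢b (trans (sym ℓx) ℓy)

  data Level (u : Fin n) : Set where
    level₀ : u ≡ v   → Level u
    level₁ : ℓ u ≡ 1 → Level u
    level₂ : ℓ u ≡ 2 → Level u
    level₃ : ℓ u ≡ 3 → Level u

  level : ∀ u → Level u
  level u with ℓ u in eq | ℓ≤3 u
  ... | 0 | _ = level₀ (ℓ≡0⇒root eq)
  ... | 1 | _ = level₁ eq
  ... | 2 | _ = level₂ eq
  ... | 3 | _ = level₃ eq
  ... | suc (suc (suc (suc _))) | s≤s (s≤s (s≤s ()))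

  peer-nontree : ∀ {u w m} → ℓ u ≡ suc m → ℓ w ≡ suc m → u ∼ w → nontree u w ≡ true
  peer-nontree ℓu ℓw u∼w = nontree⁺ u∼w
    (≢-by-ℓ (ℓ-parent ℓu) ℓw (1+n≢n ∘ sym)) (≢-by-ℓ (ℓ-parent ℓw) ℓu (1+n≢n ∘ sym))

  peer⇒nd≥1 : ∀ {u w m} → ℓ u ≡ suc m → ℓ w ≡ suc m → u ∼ w → 1 ≤ nd u
  peer⇒nd≥1 ℓu ℓw u∼w = nd≥1 (peer-nontree ℓu ℓw u∼w)

  -- A vertex at level three has no children, since they would have depth four; hence all its edges
  -- but the one to its parent are non-tree.
  level₃-nontree : ∀ {u j} → ℓ u ≡ 3 → u ∼ j → j ≢ p u → nontree u j ≡ true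
  level₃-nontree {u} {j} ℓu u∼j j≢pu = nontree⁺ u∼j (j≢pu ∘ sym) pj≢u
    where
    pj≢u : p j ≢ u
    pj≢u refl = <⇒≱ {3} ≤-refl (subst (_≤ 3) (trans (sym (ℓ-p j≢v)) (cong suc ℓu)) (ℓ≤3 j))
      where
      j≢v : j ≢ v
      j≢v refl = ≢-by-ℓ (trans (cong ℓ p-root) ℓ-root) ℓu (λ ()) refl

  level₃⇒nd≥1 : ∀ {u j} → ℓ u ≡ 3 → u ∼ j → j ≢ p u → 1 ≤ nd u
  level₃⇒nd≥1 ℓu u∼j j≢pu = nd≥1 (level₃-nontree ℓu u∼j j≢pu)

  -- On a path v, y, x, u the vertex `x` is at distance at most two from `v`. At level two it gives
  -- a non-tree edge at `u`; at level one it is the parent of `u`, and then `y` is adjacent to that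
  -- parent.
  level₂-cases : ∀ {u} → ℓ u ≡ 2 → 1 ≤ nd u ⊎ (∃ λ y → v ∼ y × y ∼ p u)
  level₂-cases {u} ℓu with saturated v u (ℓ≡suc⇒≢root ℓu ∘ sym) v≁u
    where
    v≁u : ¬ v ∼ u
    v≁u v∼u with () ← trans (sym ℓu) (∼⇒ℓ≡1 v∼u)
  ... | y , x , v≢x , _ , v∼y , y∼x , x∼u with level x
  ...   | level₀ x≡v = contradiction (sym x≡v) v≢x
  ...   | level₁ ℓx = inj₂ (y , v∼y , subst (y ∼_) (parent-unique ℓu ℓx x∼u) y∼x)
  ...   | level₂ ℓx = inj₁ (peer⇒nd≥1 ℓu ℓx (∼-sym x∼u))
  ...   | level₃ ℓx with s≤s (s≤s ()) ← subst (_≤ 2) ℓx (near⇒ℓ≤2 (y , v∼y , y∼x))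

  isolated⇒≁ : ∀ {u j} → nd u ≡ 0 → nontree u j ≢ true
  isolated⇒≁ nd≡0 nt = 1+n≰n (subst (1 ≤_) nd≡0 (nd≥1 nt))

  -- The path x ∼ t ∼ t′ ∼ x′ given by saturation must leave the first two levels.
  siblings : ∀ {x x′} → x ≢ x′ → ℓ x ≡ 2 → ℓ x′ ≡ 2 → p x ≡ p x′ → nd x ≡ 0 → nd x′ ≡ 0 →
    DegreeTwoInTriangles R → ∃ λ t → p t ≡ x × 2 ≤ nd t
  siblings {x} {x′} x≢x′ ℓx ℓx′ px≡px′ ndx ndx′ triangles
    with saturated x x′ x≢x′ (isolated⇒≁ ndx ∘ peer-nontree ℓx ℓx′)
  ... | t , t′ , x≢t′ , t≢x′ , x∼t , t∼t′ , t′∼x′ = t , pt≡x , nd-t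
    where
    -- Were `t` the common parent, `t′` would fit at no level: the root is not adjacent to `x′`, a
    -- level-one neighbour of `x′` is `t` itself, a level-two one is a non-tree neighbour of `x′`,
    -- and level three is too far from `t`.
    t≢px : t ≢ p x
    t≢px refl with level t′
    ... | level₀ refl = ≢-by-ℓ (∼⇒ℓ≡1 t′∼x′) ℓx′ (λ ()) refl
    ... | level₁ ℓt′  = ∼⇒≢ t∼t′ (trans px≡px′ (sym (parent-unique ℓx′ ℓt′ t′∼x′)))
    ... | level₂ ℓt′  = isolated⇒≁ ndx′ (peer-nontree ℓx′ ℓt′ (∼-sym t′∼x′))
    ... | level₃ ℓt′ with s≤s (s≤s ()) ←
      subst₂ (λ a b → a ≤ suc b) ℓt′ (ℓ-parent ℓx) (ℓ-lipschitz t∼t′)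

    -- Without non-tree edges at `y`, a neighbour other than the parent can only be a child.
    child : ∀ {y w} → nd y ≡ 0 → y ∼ w → w ≢ p y → p w ≡ y
    child {y} {w} ndy y∼w w≢py = decidable-stable (p w ≟ y)
      (isolated⇒≁ ndy ∘ nontree⁺ y∼w (w≢py ∘ sym))

    child-level : ∀ {y w} → ℓ y ≡ 2 → p w ≡ y → ℓ w ≡ 3
    child-level ℓy refl = trans (sym (ℓ-p w≢v)) (cong suc ℓy)
      where
      w≢v : _ ≢ v
      w≢v refl = ≢-by-ℓ (trans (cong ℓ p-root) ℓ-root) ℓy (λ ()) refl

    pt≡x : p t ≡ x
    pt≡x = child ndx x∼t t≢px

    ℓt : ℓ t ≡ 3
    ℓt = child-level ℓx pt≡x

    t′≢px′ : t′ ≢ p x′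
    t′≢px′ refl with s≤s (s≤s ()) ←
      subst₂ (λ a b → a ≤ suc b) ℓt (ℓ-parent ℓx′) (ℓ-lipschitz (∼-sym t∼t′))

    pt′≡x′ : p t′ ≡ x′
    pt′≡x′ = child ndx′ (∼-sym t′∼x′) t′≢px′

    x≁t′ : ¬ x ∼ t′
    x≁t′ x∼t′ = x≢x′ (trans (sym (child ndx x∼t′ t′≢px)) pt′≡x′)
      where
      t′≢px : t′ ≢ p x
      t′≢px eq = t′≢px′ (trans eq px≡px′)

    -- If `x` and `t′` were the only neighbours of `t`, they would be adjacent by the triangle
    -- condition, although `t′` is a child of `x′`. The edges from `t` to `t′` and to this third
    -- neighbour are the two non-tree edges sought.
    third : ∃ λ z → t ∼ z × z ≢ x × z ≢ t′
    third with any? (λ z → adjacent? R t z ×-dec ¬? (z ≟ x) ×-dec ¬? (z ≟ t′))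
    ... | yes z = z
    ... | no ¬z = contradiction (triangles t x t′ only (∼-sym x∼t) t∼t′ x≢t′) x≁t′
      where
      only : ∀ j → t ∼ j → j ≡ x ⊎ j ≡ t′
      only j t∼j with j ≟ x | j ≟ t′
      ... | yes j≡x | _        = inj₁ j≡x
      ... | no _    | yes j≡t′ = inj₂ j≡t′
      ... | no j≢x  | no j≢t′  = contradiction (j , t∼j , j≢x , j≢t′) ¬z

    nd-t : 2 ≤ nd t
    nd-t with third
    ... | z , t∼z , z≢x , z≢t′ = unique⇒≤count (nontree t) ((z≢t′ ∷ []) ∷ [] ∷ [])
      (level₃-nontree ℓt t∼z (λ z≡pt → z≢x (trans z≡pt pt≡x)) ∷
       level₃-nontree ℓt t∼t′ (λ t′≡pt → x≢t′ (sym (trans t′≡pt pt≡x))) ∷ [])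

  -- If nothing satisfies `P`, the vertex `v` is a filler, so the list of exceptions keeps its
  -- length.
  pick : ∀ {P : Fin n → Set} → (∀ u → Dec (P u)) → ∃ λ t → P t ⊎ (∀ u → ¬ P u)
  pick P? with any? P?
  ... | yes (t , Pt) = t , inj₁ Pt
  ... | no ¬∃        = v , inj₂ λ u Pu → ¬∃ (u , Pu)

  -- Root of degree one.

  module LeafRoot (w : Fin n) (v∼w : v ∼ w) (only-w : ∀ j → v ∼ j → j ≡ w) where

    Leaf₃ : Fin n → Set
    Leaf₃ t = ℓ t ≡ 3 × ¬ ∃ λ j → t ∼ j × j ≢ p t

    leaf₃? : ∀ t → Dec (Leaf₃ t)
    leaf₃? t = (ℓ t ≟ᴺ 3) ×-dec ¬? (any? λ j → adjacent? R t j ×-dec ¬? (j ≟ p t))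

    only-parent : ∀ {t j} → Leaf₃ t → t ∼ j → j ≡ p t
    only-parent {t} {j} (_ , ¬∃) t∼j = decidable-stable (j ≟ p t) λ j≢pt → ¬∃ (j , t∼j , j≢pt)

    -- The three-edge path between two leaves has their parents as its inner vertices.
    supports-adjacent : ∀ {t t′} → t ≢ t′ → Leaf₃ t → Leaf₃ t′ → p t ∼ p t′
    supports-adjacent {t} {t′} t≢t′ Lt Lt′ with saturated t t′ t≢t′ t≁t′
      where
      t≁t′ : ¬ t ∼ t′
      t≁t′ t∼t′ = ≢-by-ℓ (proj₁ Lt′) (ℓ-parent (proj₁ Lt)) (λ ()) (only-parent Lt t∼t′)
    ... | x , y , _ , _ , t∼x , x∼y , y∼t′ =
      subst₂ _∼_ (only-parent Lt t∼x) (only-parent Lt′ (∼-sym y∼t′)) x∼y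

    support-under-w : ∀ {t} → Leaf₃ t → w ∼ p t
    support-under-w Lt = subst (_∼ _) (only-w _ (ℓ≡1⇒∼ (ℓ-parent ℓpt)))
      (∼-sym (∼p (ℓ≡suc⇒≢root ℓpt)))
      where ℓpt = ℓ-parent (proj₁ Lt)

    -- Three leaves would have pairwise adjacent parents, all adjacent to `w`, and w, `p t′`, `p t`,
    -- `p t″` would be a C₄.
    no-three-leaves : ∀ {t t′ t″} → t ≢ t′ → t ≢ t″ → t′ ≢ t″ →
      Leaf₃ t → Leaf₃ t′ → Leaf₃ t″ → ⊥
    no-three-leaves t≢t′ t≢t″ t′≢t″ Lt Lt′ Lt″ = c4free
      (≢-by-ℓ (∼⇒ℓ≡1 v∼w) (ℓ-parent (proj₁ Lt)) (λ ()))
      (∼⇒≢ (supports-adjacent t′≢t″ Lt′ Lt″))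
      (support-under-w Lt′) (supports-adjacent (t≢t′ ∘ sym) Lt′ Lt)
      (supports-adjacent t≢t″ Lt Lt″) (∼-sym (support-under-w Lt″))

    bound : 3 * n ≤ sum (degree R) + 6
    bound with pick leaf₃?
    ... | t₁ , t₁-leaf with pick (λ t → leaf₃? t ×-dec ¬? (t ≟ t₁))
    ...   | t₂ , t₂-leaf = 3n≤∑degree+6 (lookup exc) covered
      where
      exc : Vec (Fin n) 4
      -- The exceptions are the root, its neighbour, and the at most two leaves at level three.
      exc = v ∷ w ∷ t₁ ∷ t₂ ∷ []

      leaf-covered : Leaf₃ t₁ ⊎ (∀ u → ¬ Leaf₃ u) →
        (Leaf₃ t₂ × t₂ ≢ t₁) ⊎ (∀ u → ¬ (Leaf₃ u × u ≢ t₁)) →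
        ∀ u → Leaf₃ u → ∃ λ i → lookup exc i ≡ u
      leaf-covered (inj₂ none) _           u Lu = contradiction Lu (none u)
      leaf-covered (inj₁ Lt₁)  second-leaf u Lu with t₁ ≟ u | t₂ ≟ u
      ... | yes t₁≡u | _        = 2F , t₁≡u
      ... | no _     | yes t₂≡u = 3F , t₂≡u
      ... | no t₁≢u  | no t₂≢u with second-leaf
      ...   | inj₁ (Lt₂ , t₂≢t₁) = ⊥-elim (no-three-leaves (t₂≢t₁ ∘ sym) t₁≢u t₂≢u Lt₁ Lt₂ Lu)
      ...   | inj₂ none          = contradiction (Lu , t₁≢u ∘ sym) (none u)

      covered : ∀ u → Covered (lookup exc) u
      covered u with level u
      ... | level₀ refl = inj₁ (0F , refl)
      ... | level₁ ℓu   = inj₁ (1F , sym (only-w u (ℓ≡1⇒∼ ℓu)))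
      ... | level₂ ℓu with level₂-cases ℓu
      ...   | inj₁ 1≤nd            = inj₂ (inj₁ 1≤nd)
      -- Both `y` and `p u` are the only neighbour `w` of the root, so this edge would be a loop.
      ...   | inj₂ (y , v∼y , y∼pu) = contradiction
        (trans (only-w y v∼y) (sym (only-w (p u) (ℓ≡1⇒∼ (ℓ-parent ℓu))))) (∼⇒≢ y∼pu)
      covered u | level₃ ℓu with any? (λ j → adjacent? R u j ×-dec ¬? (j ≟ p u))
      ... | yes (j , u∼j , j≢pu) = inj₂ (inj₁ (level₃⇒nd≥1 ℓu u∼j j≢pu))
      ... | no ¬∃                = inj₁ (leaf-covered t₁-leaf t₂-leaf u (ℓu , ¬∃))

  -- Root of degree two in a graph without leaves.

  module TwoNeighbours (a b : Fin n) (a≢b : a ≢ b) (v∼a : v ∼ a) (v∼b : v ∼ b)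
    (only-ab : ∀ j → v ∼ j → j ≡ a ⊎ j ≡ b)
    (no-leaf : ∀ u w → ∃ λ j → u ∼ j × j ≢ w) where

    level₃-covered : ∀ {u} → ℓ u ≡ 3 → 1 ≤ nd u
    level₃-covered {u} ℓu with no-leaf u (p u)
    ... | j , u∼j , j≢pu = level₃⇒nd≥1 ℓu u∼j j≢pu

    triangle-free-bound : ¬ a ∼ b → 3 * n ≤ sum (degree R) + 6
    triangle-free-bound a≁b = 3n≤∑degree+6 (lookup exc) covered
      where
      exc : Vec (Fin n) 4
      -- Three exceptions suffice here; the last `v` is padding.
      exc = v ∷ a ∷ b ∷ v ∷ []

      independent : ∀ {x y} → v ∼ x → v ∼ y → ¬ x ∼ y
      independent {x} {y} v∼x v∼y x∼y with only-ab x v∼x | only-ab y v∼y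
      ... | inj₁ refl | inj₁ refl = ∼⇒≢ x∼y refl
      ... | inj₁ refl | inj₂ refl = a≁b x∼y
      ... | inj₂ refl | inj₁ refl = a≁b (∼-sym x∼y)
      ... | inj₂ refl | inj₂ refl = ∼⇒≢ x∼y refl

      covered : ∀ u → Covered (lookup exc) u
      covered u with level u
      ... | level₀ refl = inj₁ (0F , refl)
      ... | level₁ ℓu with only-ab u (ℓ≡1⇒∼ ℓu)
      ...   | inj₁ refl = inj₁ (1F , refl)
      ...   | inj₂ refl = inj₁ (2F , refl)
      covered u | level₂ ℓu with level₂-cases ℓu
      ... | inj₁ 1≤nd             = inj₂ (inj₁ 1≤nd)
      ... | inj₂ (y , v∼y , y∼pu) = ⊥-elim (independent v∼y (ℓ≡1⇒∼ (ℓ-parent ℓu)) y∼pu)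
      covered u | level₃ ℓu = inj₂ (inj₁ (level₃-covered ℓu))

    Poor : Fin n → Fin n → Set
    Poor y u = ℓ u ≡ 2 × p u ≡ y × nd u ≡ 0

    -- The edge between `a` and `b` pays for both of them. Among the poor children of `a` one is
    -- excepted, and `siblings` compares every other with it to find a child with a surplus;
    -- likewise for `b`.
    triangle-bound : a ∼ b → DegreeTwoInTriangles R → 3 * n ≤ sum (degree R) + 6
    triangle-bound a∼b triangles with pick (poor? a) | pick (poor? b)
      where
      poor? : ∀ y u → Dec (Poor y u)
      poor? y u = (ℓ u ≟ᴺ 2) ×-dec (p u ≟ y) ×-dec (nd u ≟ᴺ 0)
    ... | x₁ , x₁-poor | x₂ , x₂-poor = 3n≤∑degree+6 (lookup exc) covered
      where
      exc : Vec (Fin n) 4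
      exc = v ∷ x₁ ∷ x₂ ∷ v ∷ []

      poor-covered : ∀ {u y x} → Poor y x ⊎ (∀ u → ¬ Poor y u) → Poor y u →
        x ≡ u ⊎ (∃ λ t → p t ≡ u × 2 ≤ nd t)
      poor-covered (inj₂ none) poor = contradiction poor (none _)
      poor-covered {u} {y} {x} (inj₁ (ℓx , px , ndx)) (ℓu , pu , ndu) with x ≟ u
      ... | yes x≡u = inj₁ x≡u
      ... | no x≢u  = inj₂ (siblings (x≢u ∘ sym) ℓu ℓx (trans pu (sym px)) ndu ndx triangles)

      covered : ∀ u → Covered (lookup exc) u
      covered u with level u
      ... | level₀ refl = inj₁ (0F , refl)
      ... | level₁ ℓu with only-ab u (ℓ≡1⇒∼ ℓu)
      ...   | inj₁ refl = inj₂ (inj₁ (peer⇒nd≥1 ℓu (∼⇒ℓ≡1 v∼b) a∼b))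
      ...   | inj₂ refl = inj₂ (inj₁ (peer⇒nd≥1 ℓu (∼⇒ℓ≡1 v∼a) (∼-sym a∼b)))
      covered u | level₃ ℓu = inj₂ (inj₁ (level₃-covered ℓu))
      covered u | level₂ ℓu with nd u ≟ᴺ 0
      ... | no nd≢0 = inj₂ (inj₁ (n≢0⇒n>0 nd≢0))
      ... | yes nd≡0 with only-ab (p u) (ℓ≡1⇒∼ (ℓ-parent ℓu))
      ...   | inj₁ pu≡a = [ (λ eq → inj₁ (1F , eq)) , inj₂ ∘ inj₂ ]′
        (poor-covered x₁-poor (ℓu , pu≡a , nd≡0))
      ...   | inj₂ pu≡b = [ (λ eq → inj₁ (2F , eq)) , inj₂ ∘ inj₂ ]′
        (poor-covered x₂-poor (ℓu , pu≡b , nd≡0))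

-- Ollmann's theorem
saturated-bound : {R : Graph n} → C4Saturated R → (∀ u → ∃ λ w → w ≢ u) → 3 * n ≤ sum (degree R) + 6
saturated-bound {n} {R} R-sat other
  with any? (λ v → any? λ w → adjacent? R v w ×-dec all? λ j → adjacent? R v j →-dec j ≟ w)
... | yes (v , w , v∼w , only-w) = Tree.LeafRoot.bound R-sat v w v∼w only-w
... | no ¬leaf = non-leaf
  where
  open C4Saturated R-sat

  neighbour : ∀ u → ∃ (R ⊢ u ∼_)
  neighbour u with other u
  ... | w , w≢u with adjacent? R u w
  ...   | yes u∼w = w , u∼w
  ...   | no u≁w with saturated u w (w≢u ∘ sym) u≁w
  ...     | x , _ , _ , _ , u∼x , _ = x , u∼x

  no-leaf : ∀ u w → ∃ λ j → R ⊢ u ∼ j × j ≢ w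
  no-leaf u w with any? (λ j → adjacent? R u j ×-dec ¬? (j ≟ w))
  ... | yes found = found
  ... | no ¬found with neighbour u
  ...   | j , u∼j = contradiction
    (u , w , subst (R ⊢ u ∼_) (only-w j u∼j) u∼j , only-w) ¬leaf
    where
    only-w : ∀ j → R ⊢ u ∼ j → j ≡ w
    only-w j u∼j = decidable-stable (j ≟ w) λ j≢w → ¬found (j , u∼j , j≢w)

  Pair : Fin n → Fin n → Fin n → Set
  Pair v a b = (∀ j → R ⊢ v ∼ j → j ≡ a ⊎ j ≡ b) × R ⊢ v ∼ a × R ⊢ v ∼ b × a ≢ b

  pair? : ∀ v a b → Dec (Pair v a b)
  pair? v a b = all? (λ j → adjacent? R v j →-dec (j ≟ a ⊎-dec j ≟ b)) ×-dec
    adjacent? R v a ×-dec adjacent? R v b ×-dec ¬? (a ≟ b)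

  non-leaf : 3 * n ≤ sum (degree R) + 6
  non-leaf with any? (λ v → any? λ a → any? λ b → pair? v a b ×-dec ¬? (adjacent? R a b))
  ... | yes (v , a , b , (only-ab , v∼a , v∼b , a≢b) , a≁b) =
    Tree.TwoNeighbours.triangle-free-bound R-sat v a b a≢b v∼a v∼b only-ab no-leaf a≁b
  -- The failure of the first search is exactly what yields the triangle condition for every vertex
  -- of degree two.
  ... | no ¬open with any? (λ v → any? λ a → any? λ b → pair? v a b)
  ...   | yes (v , a , b , only-ab , v∼a , v∼b , a≢b) =
    Tree.TwoNeighbours.triangle-bound R-sat v a b a≢b v∼a v∼b only-ab no-leaf
      (triangles v a b only-ab v∼a v∼b a≢b) triangles
    where
    triangles : DegreeTwoInTriangles R
    triangles t y z only t∼y t∼z y≢z = decidable-stable (adjacent? R y z) λ y≁z →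
      ¬open (t , y , z , (only , t∼y , t∼z , y≢z) , y≁z)
  ...   | no ¬pair = begin
    3 * n               ≡⟨ *-comm 3 n ⟩
    n * 3               ≡⟨ sum-const n 3 ⟨
    ∑[ u < n ] 3        ≤⟨ sum-mono degree≥3 ⟩
    sum (degree R)      ≤⟨ m≤m+n _ 6 ⟩
    sum (degree R) + 6  ∎
    where
    open ≤-Reasoning
    degree≥3 : ∀ u → 3 ≤ degree R u
    degree≥3 u with neighbour u
    ... | a , u∼a with no-leaf u a
    ...   | b , u∼b , b≢a with any? (λ c → adjacent? R u c ×-dec ¬? (c ≟ a) ×-dec ¬? (c ≟ b))
    ...     | yes (c , u∼c , c≢a , c≢b) = unique⇒≤count (R u)
      ((b≢a ∘ sym ∷ c≢a ∘ sym ∷ []) ∷ (c≢b ∘ sym ∷ []) ∷ [] ∷ []) (u∼a ∷ u∼b ∷ u∼c ∷ [])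
    ...     | no ¬c = contradiction (u , a , b , only , u∼a , u∼b , b≢a ∘ sym) ¬pair
      where
      only : ∀ j → R ⊢ u ∼ j → j ≡ a ⊎ j ≡ b
      only j u∼j with j ≟ a | j ≟ b
      ... | yes j≡a | _       = inj₁ j≡a
      ... | no _    | yes j≡b = inj₂ j≡b
      ... | no j≢a  | no j≢b  = contradiction (j , u∼j , j≢a , j≢b) ¬c

-- Colour classes and changes of a single edge.

redPart bluePart : Graph n → Coloring n → Graph n
redPart  G c i j = G i j ∧ c i j
bluePart G c i j = G i j ∧ not (c i j)

data New (u v : Fin n) : Fin n → Fin n → Set where
  forth : New u v u v
  back  : New u v v u

New-sym : ∀ {u v x y : Fin n} → New u v x y → New u v y x
New-sym forth = back
New-sym back  = forth

addEdge-cases : (G : Graph n) (u v : Fin n) → ∀ x y → addEdge G u v x y ≡ true →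
  G x y ≡ true ⊎ New u v x y
addEdge-cases G u v x y eq with G x y | x ≟ u | y ≟ v | x ≟ v | y ≟ u
... | true  | _        | _        | _        | _        = inj₁ refl
... | false | yes refl | yes refl | _        | _        = inj₂ forth
... | false | no _     | _        | yes refl | yes refl = inj₂ back
... | false | yes _    | no _     | yes refl | yes refl = inj₂ back
... | false | no _     | _        | no _     | _        with () ← eq
... | false | no _     | _        | yes _    | no _     with () ← eq
... | false | yes _    | no _     | no _     | _        with () ← eq
... | false | yes _    | no _     | yes _    | no _     with () ← eq

addEdge-old : (G : Graph n) (u v : Fin n) → ∀ {x y} → G x y ≡ true → addEdge G u v x y ≡ true
addEdge-old G u v {x} {y} eq rewrite eq = refl

addEdge-new : (G : Graph n) (u v : Fin n) → ∀ {x y} → New u v x y → addEdge G u v x y ≡ true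
addEdge-new G u v forth with G u v | u ≟ u | v ≟ v
... | true  | _      | _      = refl
... | false | yes _  | yes _  = refl
... | _     | no u≢u | _      = contradiction refl u≢u
... | _     | _      | no v≢v = contradiction refl v≢v
addEdge-new G u v back with G v u | u ≟ u | v ≟ v | v ≟ u | u ≟ v
... | true  | _      | _      | _        | _       = refl
... | false | yes _  | yes _  | no _     | _       = refl
... | false | yes _  | yes _  | yes _    | yes _   = refl
... | false | yes _  | yes _  | yes _    | no _    = refl
... | _     | no u≢u | _      | _        | _       = contradiction refl u≢u
... | _     | _      | no v≢v | _        | _       = contradiction refl v≢v

≡true-ext : ∀ {a b} → (a ≡ true → b ≡ true) → (b ≡ true → a ≡ true) → a ≡ b
≡true-ext {true}  {b}     f g = sym (f refl)
≡true-ext {false} {true}  f g = g refl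
≡true-ext {false} {false} f g = refl

addEdge-sym : {G : Graph n} (u v : Fin n) → (∀ i j → G i j ≡ G j i) →
  ∀ i j → addEdge G u v i j ≡ addEdge G u v j i
addEdge-sym {G = G} u v G-sym i j = ≡true-ext (turn i j) (turn j i)
  where
  turn : ∀ x y → addEdge G u v x y ≡ true → addEdge G u v y x ≡ true
  turn x y eq with addEdge-cases G u v x y eq
  ... | inj₁ Gxy = addEdge-old G u v (trans (G-sym y x) Gxy)
  ... | inj₂ new = addEdge-new G u v (New-sym new)

∧-true : ∀ {a b} → a ≡ true → b ≡ true → a ∧ b ≡ true
∧-true refl refl = refl

true≢false : ∀ {b} → b ≡ true → b ≢ false
true≢false refl ()

-- A C₄ contains the new edge at most once, and its other three edges would be a path between the
-- ends of that edge.
no-C₄-extension : {R : Graph n} → (∀ i j → R i j ≡ R j i) → C4Free R → ∀ {u v} → ¬ Path₃ R u v →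
  ∀ {a b x d} → a ≢ b → a ≢ x → a ≢ d → b ≢ x → b ≢ d → x ≢ d →
  R ⊢ a ∼ b ⊎ New u v a b → R ⊢ b ∼ x ⊎ New u v b x → R ⊢ x ∼ d ⊎ New u v x d →
  R ⊢ d ∼ a ⊎ New u v d a → ⊥
no-C₄-extension {n} {R} R-sym c4free {u} {v} ¬path = go
  where
  Edge : Fin n → Fin n → Set
  Edge x y = R ⊢ x ∼ y ⊎ New u v x y

  flip-edge : ∀ {x y} → R ⊢ x ∼ y → R ⊢ y ∼ x
  flip-edge {x} {y} = trans (R-sym y x)

  -- An edge with an end off the new edge is old.
  disjoint : ∀ {a b y z} → a ≢ y → b ≢ y → New u v a b → Edge y z → R ⊢ y ∼ z
  disjoint a≢y b≢y new   (inj₁ old)   = old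
  disjoint a≢y b≢y forth (inj₂ forth) = contradiction refl a≢y
  disjoint a≢y b≢y forth (inj₂ back)  = contradiction refl b≢y
  disjoint a≢y b≢y back  (inj₂ forth) = contradiction refl b≢y
  disjoint a≢y b≢y back  (inj₂ back)  = contradiction refl a≢y

  flip-Edge : ∀ {x y} → Edge x y → Edge y x
  flip-Edge (inj₁ old) = inj₁ (flip-edge old)
  flip-Edge (inj₂ new) = inj₂ (New-sym new)

  new-first : ∀ {a b x d} → a ≢ b → a ≢ x → a ≢ d → b ≢ x → b ≢ d → x ≢ d →
    New u v a b → Edge b x → Edge x d → Edge d a → ⊥
  new-first {a} {b} {x} {d} a≢b a≢x a≢d b≢x b≢d x≢d new bx xd da = ¬path (path new)
    where
    x∼b : R ⊢ x ∼ b
    x∼b = disjoint a≢x b≢x new (flip-Edge bx)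
    x∼d : R ⊢ x ∼ d
    x∼d = disjoint a≢x b≢x new xd
    d∼a : R ⊢ d ∼ a
    d∼a = disjoint a≢d b≢d new da
    path : New u v a b → Path₃ R u v
    path forth = d , x , a≢x , b≢d ∘ sym , flip-edge d∼a , flip-edge x∼d , x∼b
    path back  = x , d , b≢d , a≢x ∘ sym , flip-edge x∼b , x∼d , d∼a

  go : ∀ {a b x d} → a ≢ b → a ≢ x → a ≢ d → b ≢ x → b ≢ d → x ≢ d →
    Edge a b → Edge b x → Edge x d → Edge d a → ⊥
  -- The cycle is rotated until the new edge comes first.
  go ab ax ad bx bd xd (inj₂ new) e₂ e₃ e₄ = new-first ab ax ad bx bd xd new e₂ e₃ e₄
  go ab ax ad bx bd xd e₁ (inj₂ new) e₃ e₄ =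
    new-first bx bd (ab ∘ sym) xd (ax ∘ sym) (ad ∘ sym) new e₃ e₄ e₁
  go ab ax ad bx bd xd e₁ e₂ (inj₂ new) e₄ =
    new-first xd (ax ∘ sym) (bx ∘ sym) (ad ∘ sym) (bd ∘ sym) ab new e₄ e₁ e₂
  go ab ax ad bx bd xd e₁ e₂ e₃ (inj₂ new) =
    new-first (ad ∘ sym) (bd ∘ sym) (xd ∘ sym) ab ax bx new e₁ e₂ e₃
  go ab ax ad bx bd xd (inj₁ e₁) (inj₁ e₂) (inj₁ e₃) (inj₁ e₄) = c4free ax bd e₁ e₂ e₃ e₄

module Colouring {n k} {G : Graph n} (G-simple : IsSimple G)
  {c : Coloring n} (c-critical : Critical k G c) where
  open IsSimple G-simple renaming (sym to G-sym; irrefl to G-irrefl)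
  open Critical c-critical

  R B : Graph n
  R = redPart G c
  B = bluePart G c

  R-simple : IsSimple R
  R-simple = record
    { sym    = λ i j → cong₂ _∧_ (G-sym i j) (csym i j)
    ; irrefl = λ i → cong (_∧ c i i) (G-irrefl i)
    }

  R⇒RedEdge : ∀ {x y} → R ⊢ x ∼ y → RedEdge G c x y
  R⇒RedEdge {x} {y} eq = ∧-conicalˡ (G x y) (c x y) eq , ∧-conicalʳ (G x y) (c x y) eq

  R-c4free : C4Free R
  R-c4free {a} {b} {x} {d} a≢x b≢d ab bx xd da = noC4
    (a , b , x , d , ≢ ab , a≢x , ≢ da ∘ sym , ≢ bx , b≢d , ≢ xd ,
     R⇒RedEdge ab , R⇒RedEdge bx , R⇒RedEdge xd , R⇒RedEdge da)
    where
    ≢ : ∀ {x y} → R ⊢ x ∼ y → x ≢ y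
    ≢ {x} eq refl = true≢false eq (IsSimple.irrefl R-simple x)

  recolour-c4free : ∀ {G′ c′ u v} → (∀ {x y} → RedEdge G′ c′ x y → R ⊢ x ∼ y ⊎ New u v x y) →
    ¬ Path₃ R u v → ¬ RedC4 G′ c′
  recolour-c4free split ¬path
    (a , b , x , d , ab , ax , ad , bx , bd , xd , e₁ , e₂ , e₃ , e₄) =
    no-C₄-extension (IsSimple.sym R-simple) R-c4free ¬path ab ax ad bx bd xd
      (split e₁) (split e₂) (split e₃) (split e₄)

  -- Here `addEdge` acts on the colouring and turns the edge red. Blue edges only disappear, so no
  -- blue star arises.
  redden-blue : ∀ {u v} → G u v ≡ true → ¬ Path₃ R u v → Critical k G (addEdge c u v)
  redden-blue {u} {v} Guv ¬path = record
    { csym   = addEdge-sym u v csym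
    ; noC4   = recolour-c4free split ¬path
    ; noStar = λ (w , f , f-inj , blue-leaf) → noStar (w , f , f-inj , λ i →
        let fi≢w , Gwfi , new-blue = blue-leaf i in
        fi≢w , Gwfi , ¬-not λ was-red → true≢false (addEdge-old c u v was-red) new-blue)
    }
    where
    split : ∀ {x y} → RedEdge G (addEdge c u v) x y → R ⊢ x ∼ y ⊎ New u v x y
    split (Gxy , red′) with addEdge-cases c u v _ _ red′
    ... | inj₁ cxy = inj₁ (∧-true Gxy cxy)
    ... | inj₂ new = inj₂ new

  -- The new edge is red, so every blue star consists of old edges, blue before.
  add-red : ∀ {u v} → ¬ Path₃ R u v → Critical k (addEdge G u v) (addEdge c u v)
  add-red {u} {v} ¬path = record
    { csym   = addEdge-sym u v csym
    ; noC4   = recolour-c4free split ¬path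
    ; noStar = λ (w , f , f-inj , blue-leaf) → noStar (w , f , f-inj , λ i →
        let fi≢w , Gwfi , new-blue = blue-leaf i in
        fi≢w ,
        [ (λ old → old) , (λ new → contradiction new-blue (true≢false (addEdge-new c u v new))) ]′
          (addEdge-cases G u v w (f i) Gwfi) ,
        ¬-not λ was-red → true≢false (addEdge-old c u v was-red) new-blue)
    }
    where
    split : ∀ {x y} → RedEdge (addEdge G u v) (addEdge c u v) x y → R ⊢ x ∼ y ⊎ New u v x y
    split (G′xy , c′xy) with addEdge-cases G u v _ _ G′xy | addEdge-cases c u v _ _ c′xy
    ... | inj₂ new | _        = inj₂ new
    ... | _        | inj₂ new = inj₂ new
    ... | inj₁ Gxy | inj₁ cxy = inj₁ (∧-true Gxy cxy)

  -- The colouring R makes every edge outside G blue.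
  add-blue : ∀ {u v} → G u v ≡ false → degree B u + 2 ≤ k → degree B v + 2 ≤ k →
    Critical k (addEdge G u v) R
  add-blue {u} {v} Guv du dv = record
    { csym   = IsSimple.sym R-simple
    ; noC4   = λ (a , b , x , d , ab , ax , ad , bx , bd , xd , (_ , e₁) , (_ , e₂) , (_ , e₃) , (_ , e₄)) →
        R-c4free ax bd e₁ e₂ e₃ e₄
    ; noStar = no-star
    }
    where
    blue-old : ∀ {x y} → G x y ≡ true → R x y ≡ false → c x y ≡ blue
    blue-old Gxy Rxy = ¬-not λ cxy → true≢false (∧-true Gxy cxy) Rxy

    -- An end of the new edge gains only the other end `z` as a blue neighbour, so its blue degree
    -- is at most k - 1.
    no-star-at-end : ∀ {w z} → degree B w + 2 ≤ k → (∀ y → New u v w y → y ≡ z) →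
      (f : Fin k → Fin n) → Injective _≡_ _≡_ f →
      (∀ i → f i ≢ w × addEdge G u v w (f i) ≡ true × R w (f i) ≡ false) → ⊥
    no-star-at-end {w} {z} dw end f f-inj blue-leaf = 1+n≰n (begin
      suc (degree B w + 1)                  ≡⟨ +-suc (degree B w) 1 ⟨
      degree B w + 2                        ≤⟨ dw ⟩
      k                                     ≤⟨ injection⇒≤count P f f-inj Pf ⟩
      count P                               ≤⟨ sum-mono P≤ ⟩
      ∑[ j < n ] (⟦ B w j ⟧ + δ z j)        ≡⟨ ∑-distrib-+ (λ j → ⟦ B w j ⟧) (δ z) ⟩
      degree B w + sum (δ z)                ≡⟨ cong (degree B w +_) (sum-δ₁ z) ⟩
      degree B w + 1                        ∎)
      where
      open ≤-Reasoning
      P : Fin n → Bool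
      P j = B w j ∨ does (z ≟ j)
      P≤ : ∀ j → ⟦ P j ⟧ ≤ ⟦ B w j ⟧ + δ z j
      P≤ j with B w j
      ... | true  = s≤s z≤n
      ... | false = ≤-refl
      Pf : ∀ i → P (f i) ≡ true
      Pf i with blue-leaf i
      ... | _ , G′ , Rwfi with addEdge-cases G u v w (f i) G′
      ...   | inj₁ Gwfi = cong (_∨ _) (∧-true Gwfi (cong not (blue-old {w} {f i} Gwfi Rwfi)))
      ...   | inj₂ new rewrite dec-true (z ≟ f i) (sym (end (f i) new)) = ∨-zeroʳ _

    no-star-from : ∀ w → Dec (w ≡ u) → Dec (w ≡ v) → (f : Fin k → Fin n) → Injective _≡_ _≡_ f →
      (∀ i → f i ≢ w × addEdge G u v w (f i) ≡ true × R w (f i) ≡ false) → ⊥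
    no-star-from w (yes refl) _ = no-star-at-end du (λ { _ forth → refl ; _ back → refl })
    no-star-from w (no _) (yes refl) = no-star-at-end dv (λ { _ forth → refl ; _ back → refl })
    no-star-from w (no w≢u) (no w≢v) f f-inj blue-leaf = noStar (w , f , f-inj , λ i →
      let fi≢w , G′ , Rwfi = blue-leaf i in fi≢w , old i G′ , blue-old {w} {f i} (old i G′) Rwfi)
      where
      old : ∀ i → addEdge G u v w (f i) ≡ true → G w (f i) ≡ true
      old i G′ with addEdge-cases G u v w (f i) G′
      ... | inj₁ Gwfi  = Gwfi
      ... | inj₂ forth = contradiction refl w≢u
      ... | inj₂ back  = contradiction refl w≢v

    no-star : ¬ BlueStar k (addEdge G u v) R
    no-star (w , f , f-inj , blue-leaf) = no-star-from w (w ≟ u) (w ≟ v) f f-inj blue-leaf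

-- Colourings in which no further blue edge can turn red.

Settled : (G : Graph n) → Coloring n → Set
Settled G c = ∀ u v → G u v ≡ true → c u v ≡ blue → Path₃ (redPart G c) u v

-- Blue edges are turned red as long as no red C₄ arises. The red degree sum grows strictly and
-- never exceeds n², so starting with n² + 1 units of fuel the recolouring stops before they run
-- out.
settle : {G : Graph n} → IsSimple G → HasCritical k G → ∃ λ c → Critical k G c × Settled G c
settle {n} {k} {G} G-simple (c₀ , c₀-critical) = go (suc (n * n)) c₀ c₀-critical (m≤n+m _ _)
  where
  reds : Coloring n → ℕ
  reds c = sum (degree (redPart G c))

  reds≤n² : ∀ c → reds c ≤ n * n
  reds≤n² c = ≤-trans (sum-mono row) (≤-reflexive (sum-const n n))
    where
    row : ∀ i → degree (redPart G c) i ≤ n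
    row i = ≤-trans (sum-mono (λ j → ⟦⟧≤1 (redPart G c i j))) (≤-reflexive (sum-one n))

  reds-grow : ∀ c u v → G u v ≡ true → c u v ≡ blue → reds c < reds (addEdge c u v)
  reds-grow c u v Guv cuv = sum-mono-< (λ i → sum-mono (entry i)) u (sum-mono-< (entry u) v new-entry)
    where
    entry : ∀ i j → ⟦ redPart G c i j ⟧ ≤ ⟦ redPart G (addEdge c u v) i j ⟧
    entry i j with G i j | c i j
    ... | false | _     = z≤n
    ... | true  | true  = ≤-refl
    ... | true  | false = z≤n
    new-entry : ⟦ redPart G c u v ⟧ < ⟦ redPart G (addEdge c u v) u v ⟧
    new-entry rewrite Guv | addEdge-new c u v forth | cuv = ≤-refl

  go : ∀ fuel c → Critical k G c → n * n < reds c + fuel → ∃ λ c → Critical k G c × Settled G c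
  go zero c _ lt = contradiction (≤-trans lt (≤-reflexive (+-identityʳ _))) (≤⇒≯ (reds≤n² c))
  go (suc fuel) c c-critical lt
    with any? (λ u → any? λ v →
      (G u v ≟ᵇ true) ×-dec (c u v ≟ᵇ blue) ×-dec ¬? (path₃? (redPart G c) u v))
  ... | yes (u , v , Guv , cuv , ¬path) =
    go fuel (addEdge c u v) (Colouring.redden-blue G-simple c-critical Guv ¬path)
      (≤-trans lt (≤-trans (≤-reflexive (+-suc (reds c) fuel)) (+-monoˡ-≤ fuel (reds-grow c u v Guv cuv))))
  ... | no ¬∃ = c , c-critical , λ u v Guv cuv →
    decidable-stable (path₃? (redPart G c) u v) λ ¬path → ¬∃ (u , v , Guv , cuv , ¬path)

-- Edge counts and degree sums.

sum-allFin : (f : Fin n → ℕ) → ListAction.sum (List.map f (List.allFin n)) ≡ sum f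
sum-allFin f = trans (cong ListAction.sum (map-tabulate (λ i → i) f)) (sum-tabulate f)
  where
  sum-tabulate : ∀ {n} (f : Fin n → ℕ) → ListAction.sum (List.tabulate f) ≡ sum f
  sum-tabulate {zero}  f = refl
  sum-tabulate {suc n} f = cong (f zero +_) (sum-tabulate (f ∘ suc))

-- The adjacency matrix is its strictly upper triangle plus the transpose of that triangle.
handshake : {G : Graph n} → IsSimple G → 2 * e G ≡ sum (degree G)
handshake {n} {G} G-simple = begin
  2 * e G
    ≡⟨ cong (2 *_) (trans (sum-allFin (λ i → ListAction.sum (List.map (upper i) (List.allFin n))))
         (sum-cong-≗ (λ i → sum-allFin (upper i)))) ⟩
  2 * U
    ≡⟨ cong (U +_) (+-identityʳ U) ⟩
  U + U
    ≡⟨ cong (U +_) (∑-comm upper) ⟩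
  U + ∑[ i < n ] ∑[ j < n ] upper j i
    ≡⟨ ∑-distrib-+ (λ i → sum (upper i)) (λ i → ∑[ j < n ] upper j i) ⟨
  ∑[ i < n ] (sum (upper i) + ∑[ j < n ] upper j i)
    ≡⟨ sum-cong-≗ (λ i → trans (sym (∑-distrib-+ (upper i) (λ j → upper j i)))
         (sum-cong-≗ (entry i))) ⟩
  sum (degree G) ∎
  where
  open ≡-Reasoning
  open IsSimple G-simple renaming (sym to G-sym; irrefl to G-irrefl)
  upper : Fin n → Fin n → ℕ
  upper i j = ⟦ ⌊ i <ᶠ? j ⌋ ∧ G i j ⟧
  U : ℕ
  U = ∑[ i < n ] sum (upper i)
  entry : ∀ i j → upper i j + upper j i ≡ ⟦ G i j ⟧
  entry i j with i <ᶠ? j | j <ᶠ? i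
  ... | yes i<j | yes j<i = contradiction j<i (<-asym i<j)
  ... | yes _   | no _    = +-identityʳ _
  ... | no _    | yes _   = cong ⟦_⟧ (G-sym j i)
  ... | no i≮j  | no j≮i rewrite toℕ-injective (≤-antisym (≮⇒≥ j≮i) (≮⇒≥ i≮j)) =
    cong ⟦_⟧ (sym (G-irrefl j))

degree-split : (G : Graph n) (c : Coloring n) →
  sum (degree G) ≡ sum (degree (redPart G c)) + sum (degree (bluePart G c))
degree-split G c = trans
  (sum-cong-≗ λ u → trans (sum-cong-≗ (entry u))
    (∑-distrib-+ (λ j → ⟦ redPart G c u j ⟧) (λ j → ⟦ bluePart G c u j ⟧)))
  (∑-distrib-+ (degree (redPart G c)) (degree (bluePart G c)))
  where
  entry : ∀ u j → ⟦ G u j ⟧ ≡ ⟦ redPart G c u j ⟧ + ⟦ bluePart G c u j ⟧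
  entry u j with G u j | c u j
  ... | false | _     = refl
  ... | true  | true  = refl
  ... | true  | false = refl

-- Vertices of low blue degree.

module LowBlueDegree {n} {R : Graph n} (R-simple : IsSimple R) (R-c4free : C4Free R) 
  (B : Graph n) (m s : ℕ)
  (m<[s+1]² : m < suc s * suc s)
  (low-clique : ∀ u v → degree B u ≤ m → degree B v ≤ m → u ≢ v → R u v ∨ B u v ≡ true) where

  -- In the application `m` is k - 2, so the low vertices are those of blue degree below k - 1.
  low : Fin n → Bool
  low u = does (degree B u ≤? m)

  b : ℕ
  b = count low

  ρ : Fin n → ℕ
  ρ u = ∑[ j < n ] ⟦ low j ∧ R u j ⟧

  low⇒≤ : ∀ {u} → low u ≡ true → degree B u ≤ m
  low⇒≤ {u} = dec-sound (degree B u ≤? m)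

  -- Since the low vertices form a clique, each of them is `u`, a blue neighbour of `u`, or a red
  -- one.
  b≤1+d+ρ : ∀ {u} → low u ≡ true → b ≤ 1 + degree B u + ρ u
  b≤1+d+ρ {u} low-u = begin
    b                                                        ≤⟨ sum-mono entry ⟩
    ∑[ j < n ] (δ u j + ⟦ B u j ⟧ + ⟦ low j ∧ R u j ⟧)       ≡⟨ ∑-distrib-+ (λ j → δ u j + ⟦ B u j ⟧) (λ j → ⟦ low j ∧ R u j ⟧) ⟩
    ∑[ j < n ] (δ u j + ⟦ B u j ⟧) + ρ u                     ≡⟨ cong (_+ ρ u) (∑-distrib-+ (δ u) (λ j → ⟦ B u j ⟧)) ⟩
    sum (δ u) + degree B u + ρ u                             ≡⟨ cong (λ a → a + degree B u + ρ u) (sum-δ₁ u) ⟩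
    1 + degree B u + ρ u                                     ∎
    where
    open ≤-Reasoning
    entry : ∀ j → ⟦ low j ⟧ ≤ δ u j + ⟦ B u j ⟧ + ⟦ low j ∧ R u j ⟧
    entry j with low j in low-j
    ... | false = z≤n
    ... | true with u ≟ j
    ...   | yes _ = s≤s z≤n
    ...   | no u≢j with R u j | B u j | low-clique u j (low⇒≤ low-u) (low⇒≤ low-j) u≢j
    ...     | true  | true  | _ = s≤s z≤n
    ...     | true  | false | _ = ≤-refl
    ...     | false | true  | _ = ≤-refl

  two-paths : Fin n → Fin n → ℕ
  two-paths u z = ∑[ w < n ] (⟦ low w ∧ R u w ⟧ * ⟦ low z ∧ R w z ⟧)

  -- The left sum counts red walks of length two from `u` through low vertices. At most `ρ u` of
  -- them return to `u`; each of the b - 1 other low vertices is reached at most once, as two walks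
  -- would form a red C₄.
  ∑ρ<ρ+b : ∀ {u} → low u ≡ true → ∑[ w < n ] (⟦ low w ∧ R u w ⟧ * ρ w) + 1 ≤ ρ u + b
  ∑ρ<ρ+b {u} low-u = begin
    ∑[ w < n ] (⟦ low w ∧ R u w ⟧ * ρ w) + 1
      ≡⟨ cong₂ _+_ (trans (sum-cong-≗ (λ w → *-distribˡ-sum ⟦ low w ∧ R u w ⟧ (λ z → ⟦ low z ∧ R w z ⟧)))
           (∑-comm (λ w z → ⟦ low w ∧ R u w ⟧ * ⟦ low z ∧ R w z ⟧))) (sym (sum-δ₁ u)) ⟩
    sum (two-paths u) + sum (δ u)
      ≡⟨ ∑-distrib-+ (two-paths u) (δ u) ⟨
    ∑[ z < n ] (two-paths u z + δ u z)
      ≤⟨ sum-mono entry ⟩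
    ∑[ z < n ] (δ u z * ρ u + ⟦ low z ⟧)
      ≡⟨ ∑-distrib-+ (λ z → δ u z * ρ u) (λ z → ⟦ low z ⟧) ⟩
    ∑[ z < n ] (δ u z * ρ u) + b
      ≡⟨ cong (_+ b) (sum-δ u (λ _ → ρ u)) ⟩
    ρ u + b ∎
    where
    open ≤-Reasoning
    open IsSimple R-simple renaming (sym to R-sym; irrefl to R-irrefl)

    closed : two-paths u u ≤ ρ u
    closed = sum-mono λ w → ≤-trans (*-monoʳ-≤ ⟦ low w ∧ R u w ⟧ (⟦⟧≤1 _)) (≤-reflexive (*-identityʳ _))

    common : ∀ z → u ≢ z → two-paths u z ≤ ⟦ low z ⟧
    common z u≢z with low z
    ... | false = ≤-reflexive (trans (sum-cong-≗ (λ w → *-zeroʳ ⟦ low w ∧ R u w ⟧)) (sum-zero n))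
    ... | true  = ≤-trans (sum-mono weaken) (count≤1 (λ w → R u w ∧ R w z) unique)
      where
      weaken : ∀ w → ⟦ low w ∧ R u w ⟧ * ⟦ R w z ⟧ ≤ ⟦ R u w ∧ R w z ⟧
      weaken w with low w | R u w | R w z
      ... | false | _     | _     = z≤n
      ... | true  | false | _     = z≤n
      ... | true  | true  | true  = ≤-refl
      ... | true  | true  | false = ≤-refl
      unique : ∀ w w′ → R u w ∧ R w z ≡ true → R u w′ ∧ R w′ z ≡ true → w ≡ w′
      unique w w′ eq eq′ = decidable-stable (w ≟ w′) λ w≢w′ → R-c4free u≢z w≢w′
        (∧-conicalˡ _ _ eq) (∧-conicalʳ (R u w) _ eq)
        (trans (R-sym z w′) (∧-conicalʳ (R u w′) _ eq′)) (trans (R-sym w′ u) (∧-conicalˡ _ _ eq′))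

    entry : ∀ z → two-paths u z + δ u z ≤ δ u z * ρ u + ⟦ low z ⟧
    entry z with u ≟ z
    ... | no u≢z = ≤-trans (≤-reflexive (+-identityʳ _)) (common z u≢z)
    ... | yes refl = +-mono-≤ (≤-trans closed (≤-reflexive (sym (+-identityʳ _)))) (≤-reflexive (cong ⟦_⟧ (sym low-u)))

  module Large (j : ℕ) (b≡ : m + 3 + s + j ≡ b) where

    ρ≥ : ∀ {u} → low u ≡ true → 2 + s + j ≤ ρ u
    ρ≥ {u} low-u = +-cancelˡ-≤ (1 + m) _ _ (begin
      1 + m + (2 + s + j)      ≡⟨ regroup m s j ⟩
      m + 3 + s + j            ≡⟨ b≡ ⟩
      b                        ≤⟨ b≤1+d+ρ low-u ⟩
      1 + degree B u + ρ u     ≤⟨ +-monoˡ-≤ (ρ u) (s≤s (low⇒≤ low-u)) ⟩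
      1 + m + ρ u              ∎)
      where
      open ≤-Reasoning
      regroup : ∀ m s j → 1 + m + (2 + s + j) ≡ m + 3 + s + j
      regroup = solve-∀

    -- Each low red neighbour of `u` has at least 2 + s + j low red neighbours by `ρ≥`, which bounds
    -- the walks of length two from below; their upper bound and m + 1 ≤ (s + 1)² give the rest.
    ρ*≤ : ∀ {u} → low u ≡ true → ρ u * (1 + s + j) ≤ (s + 1) * (s + 2) + j
    ρ*≤ {u} low-u = +-cancelˡ-≤ (ρ u + 1) _ _ (begin
      ρ u + 1 + ρ u * (1 + s + j)                        ≡⟨ regroup₁ (ρ u) s j ⟩
      ρ u * (2 + s + j) + 1                              ≡⟨ cong (_+ 1) (*-distribʳ-sum (2 + s + j) (λ w → ⟦ low w ∧ R u w ⟧)) ⟩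
      ∑[ w < n ] (⟦ low w ∧ R u w ⟧ * (2 + s + j)) + 1   ≤⟨ +-monoˡ-≤ 1 (sum-mono entry) ⟩
      ∑[ w < n ] (⟦ low w ∧ R u w ⟧ * ρ w) + 1           ≤⟨ ∑ρ<ρ+b low-u ⟩
      ρ u + b                                            ≡⟨ cong (ρ u +_) b≡ ⟨
      ρ u + (m + 3 + s + j)                              ≡⟨ regroup₂ (ρ u) m s j ⟩
      ρ u + 1 + (suc m + (1 + s + j))                    ≤⟨ +-monoʳ-≤ (ρ u + 1) (+-monoˡ-≤ (1 + s + j) m<[s+1]²) ⟩
      ρ u + 1 + (suc s * suc s + (1 + s + j))            ≡⟨ cong (ρ u + 1 +_) (regroup₃ s j) ⟩
      ρ u + 1 + ((s + 1) * (s + 2) + j)                  ∎)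
      where
      open ≤-Reasoning
      regroup₁ : ∀ r s j → r + 1 + r * (1 + s + j) ≡ r * (2 + s + j) + 1
      regroup₁ = solve-∀
      regroup₂ : ∀ r m s j → r + (m + 3 + s + j) ≡ r + 1 + (1 + m + (1 + s + j))
      regroup₂ = solve-∀
      regroup₃ : ∀ s j → (1 + s) * (1 + s) + (1 + s + j) ≡ (s + 1) * (s + 2) + j
      regroup₃ = solve-∀
      entry : ∀ w → ⟦ low w ∧ R u w ⟧ * (2 + s + j) ≤ ⟦ low w ∧ R u w ⟧ * ρ w
      entry w with low w in low-w
      ... | false = z≤n
      ... | true  = *-monoʳ-≤ ⟦ R u w ⟧ (ρ≥ low-w)

    -- The lower and the upper bound on `ρ u` together give (2 + s + j)(1 + s + j) ≤ (s + 1)(s + 2)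
    -- + j. The left side is larger by j(2s + 2 + j).
    j≡0 : ∀ {u} → low u ≡ true → j ≡ 0
    j≡0 {u} low-u = n<1⇒n≡0 (≰⇒> λ 1≤j → 1+n≰n (begin
      suc ((s + 1) * (s + 2) + j)              ≤⟨ +-monoˡ-≤ ((s + 1) * (s + 2) + j) (≤-trans 1≤j (m≤m*n j (1 + (2 * s + 1 + j)))) ⟩
      j * (1 + (2 * s + 1 + j)) + ((s + 1) * (s + 2) + j) ≡⟨ expand s j ⟩
      (2 + s + j) * (1 + s + j)                ≤⟨ *-monoˡ-≤ (1 + s + j) (ρ≥ low-u) ⟩
      ρ u * (1 + s + j)                        ≤⟨ ρ*≤ low-u ⟩
      (s + 1) * (s + 2) + j                    ∎))
      where
      open ≤-Reasoning
      expand : ∀ s j → j * (1 + (2 * s + 1 + j)) + ((s + 1) * (s + 2) + j) ≡ (2 + s + j) * (1 + s + j)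
      expand = solve-∀

  -- For j = 0 the product bound reads `ρ u` ≤ s + 2, and a clique of m + 3 + s vertices then needs
  -- `m` blue neighbours at `u`.
  tight : ∀ {u} → m + 3 + s + 0 ≡ b → low u ≡ true → m ≤ degree B u
  tight {u} b≡ low-u = +-cancelʳ-≤ (3 + s) _ _ (begin
    m + (3 + s)                 ≡⟨ regroup₁ m s ⟩
    m + 3 + s + 0               ≡⟨ b≡ ⟩
    b                           ≤⟨ b≤1+d+ρ low-u ⟩
    1 + degree B u + ρ u        ≤⟨ +-monoʳ-≤ (1 + degree B u) ρ≤ ⟩
    1 + degree B u + (s + 2)    ≡⟨ regroup₂ (degree B u) s ⟩
    degree B u + (3 + s)        ∎)
    where
    open ≤-Reasoning
    open Large 0 b≡
    regroup₁ : ∀ m s → m + (3 + s) ≡ m + 3 + s + 0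
    regroup₁ = solve-∀
    regroup₂ : ∀ d s → 1 + d + (s + 2) ≡ d + (3 + s)
    regroup₂ = solve-∀
    regroup₃ : ∀ s → (s + 1) * (s + 2) + 0 ≡ (s + 2) * (1 + s + 0)
    regroup₃ = solve-∀
    ρ≤ : ρ u ≤ s + 2
    ρ≤ = *-cancelʳ-≤ (ρ u) (s + 2) (1 + s + 0) (≤-trans (ρ*≤ low-u) (≤-reflexive (regroup₃ s)))

  deficit-bound : ∀ d → (∀ u → suc m ≤ degree B u + d * ⟦ low u ⟧) → suc m * n ≤ sum (degree B) + d * b
  deficit-bound d pointwise = begin
    suc m * n                                    ≡⟨ *-comm (suc m) n ⟩
    n * suc m                                    ≡⟨ sum-const n (suc m) ⟨
    ∑[ u < n ] suc m                             ≤⟨ sum-mono pointwise ⟩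
    ∑[ u < n ] (degree B u + d * ⟦ low u ⟧)      ≡⟨ ∑-distrib-+ (degree B) (λ u → d * ⟦ low u ⟧) ⟩
    sum (degree B) + ∑[ u < n ] (d * ⟦ low u ⟧)  ≡⟨ cong (sum (degree B) +_) (*-distribˡ-sum d (λ u → ⟦ low u ⟧)) ⟨
    sum (degree B) + d * b                       ∎
    where open ≤-Reasoning

  not-low⇒> : ∀ {u} → low u ≡ false → suc m ≤ degree B u
  not-low⇒> {u} ¬low = ≰⇒> λ d≤m → true≢false (dec-true (degree B u ≤? m) d≤m) ¬low

  -- Up to m + 2 + s = k + s low vertices may each lack the full m + 1. With more there are exactly
  -- m + 3 + s, and by `tight` each lacks only one.
  blue-bound : suc m * n ≤ sum (degree B) + suc m * (m + 2 + s) ⊎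
    suc m * n ≤ sum (degree B) + (m + 3 + s)
  blue-bound with b ≤? m + 2 + s
  ... | yes b≤ = inj₁ (≤-trans (deficit-bound (suc m) pointwise)
    (+-monoʳ-≤ (sum (degree B)) (*-monoʳ-≤ (suc m) b≤)))
    where
    pointwise : ∀ u → suc m ≤ degree B u + suc m * ⟦ low u ⟧
    pointwise u with low u in low-u
    ... | true  = ≤-trans (≤-reflexive (sym (*-identityʳ (suc m)))) (m≤n+m _ _)
    ... | false = ≤-trans (not-low⇒> low-u) (m≤m+n _ _)
  -- The excess is written as b = m + 3 + s + j; any low vertex then forces j = 0.
  ... | no b≰ with m≤n⇒∃[o]m+o≡n (≰⇒> b≰)
  ...   | j , eq with any? (λ u → low u ≟ᵇ true)
  ...     | no none = contradiction (≤-trans b≤0 z≤n) b≰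
    where
    b≤0 : b ≤ 0
    b≤0 = ≤-trans (sum-mono (λ u → ≤-reflexive (cong ⟦_⟧ (¬-not (λ low-u → none (u , low-u))))))
      (≤-reflexive (sum-zero n))
  ...     | yes (u , low-u) with Large.j≡0 j (trans (shift m s j) eq) low-u
    where
    shift : ∀ m s j → m + 3 + s + j ≡ suc (m + 2 + s) + j
    shift = solve-∀
  ...       | refl = inj₂ (≤-trans (deficit-bound 1 pointwise)
    (≤-reflexive (cong (sum (degree B) +_) 1*b≡)))
    where
    b≡ : m + 3 + s + 0 ≡ b
    b≡ = trans (shift m s) eq
      where
      shift : ∀ m s → m + 3 + s + 0 ≡ suc (m + 2 + s) + 0
      shift = solve-∀
    1*b≡ : 1 * b ≡ m + 3 + s
    1*b≡ = trans (*-identityˡ b) (trans (sym b≡) (+-identityʳ _))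
    pointwise : ∀ u → suc m ≤ degree B u + 1 * ⟦ low u ⟧
    pointwise u with low u in low-u
    ... | true  = ≤-trans (s≤s (tight b≡ low-u)) (≤-reflexive (+-comm 1 (degree B u)))
    ... | false = ≤-trans (not-low⇒> low-u) (m≤m+n _ _)

-- Consequences of co-criticality for a settled colouring.

module Settlement {n k} {G : Graph n} (G-cocritical : CoCritical k G) {c : Coloring n}
  (c-critical : Critical k G c) (c-settled : Settled G c) where
  open CoCritical G-cocritical
  open Colouring simple c-critical

  -- A pair not joined in red is either a blue edge, where settledness gives the path, or a non-edge
  -- of `G`, which could otherwise be added in red.
  R-saturated : C4Saturated R
  R-saturated = record { simple = R-simple ; c4free = R-c4free ; saturated = paths }
    where
    paths : ∀ u v → u ≢ v → ¬ R ⊢ u ∼ v → Path₃ R u v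
    paths u v u≢v u≁v with G u v in Guv
    ... | true  = c-settled u v Guv (¬-not u≁v)
    ... | false = decidable-stable (path₃? R u v) λ ¬path →
      saturated u v u≢v Guv (addEdge c u v , add-red ¬path)

  -- A missing edge could be added in blue without completing a blue star.
  low-clique : ∀ u v → degree B u + 2 ≤ k → degree B v + 2 ≤ k → u ≢ v → R u v ∨ B u v ≡ true
  low-clique u v du dv u≢v with G u v in Guv
  ... | false = contradiction (R , add-blue Guv du dv) (saturated u v u≢v Guv)
  ... | true with c u v
  ...   | true  = refl
  ...   | false = refl

  other : ∀ u → ∃ λ w → w ≢ u
  other u with noncomplete
  ... | x , y , x≢y , _ with x ≟ u
  ...   | no x≢u   = x , x≢u
  ...   | yes refl = y , x≢y ∘ sym

-- Combining the red and the blue bound.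

halve : ∀ a b → 2 * a ≤ 2 * b + 1 → a ≤ b
halve a b le = ≮⇒≥ λ b<a → 1+n≰n (begin
  suc (2 * b + 1)  ≡⟨ double b ⟩
  2 * suc b        ≤⟨ *-monoʳ-≤ 2 b<a ⟩
  2 * a            ≤⟨ le ⟩
  2 * b + 1        ∎)
  where
  open ≤-Reasoning
  double : ∀ b → 1 + (2 * b + 1) ≡ 2 * (1 + b)
  double = solve-∀

-- For m = 0 the two bounds add up to one too much, which parity removes.
combine : ∀ m s n E r b → s * s ≤ m → 2 * E ≡ r + b → 3 * n ≤ r + 6 →
  suc m * n ≤ b + suc m * (m + 2 + s) ⊎ suc m * n ≤ b + (m + 3 + s) →
  (suc (suc m) + 2) * n ≤ 2 * E + 6 + suc m * (suc (suc m) + s)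
combine m s n E r b s²≤m 2E≡ red-bound blue-bound = by-cases m s s²≤m blue-bound
  where
  open ≤-Reasoning
  total : ∀ m {d} → suc m * n ≤ b + d → (suc (suc m) + 2) * n ≤ 2 * E + 6 + d
  total m {d} bound = begin
    (suc (suc m) + 2) * n    ≡⟨ split m n ⟩
    3 * n + suc m * n        ≤⟨ +-mono-≤ red-bound bound ⟩
    (r + 6) + (b + d)        ≡⟨ regroup r b d ⟩
    r + b + 6 + d            ≡⟨ cong (λ t → t + 6 + d) 2E≡ ⟨
    2 * E + 6 + d            ∎
    where
    split : ∀ m n → (2 + m + 2) * n ≡ 3 * n + (1 + m) * n
    split = solve-∀
    regroup : ∀ r b d → (r + 6) + (b + d) ≡ r + b + 6 + d
    regroup = solve-∀

  by-cases : ∀ m s → s * s ≤ m →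
    suc m * n ≤ b + suc m * (m + 2 + s) ⊎ suc m * n ≤ b + (m + 3 + s) →
    (suc (suc m) + 2) * n ≤ 2 * E + 6 + suc m * (suc (suc m) + s)
  by-cases m s _ (inj₁ bound) = ≤-trans (total m bound)
    (≤-reflexive (cong (λ t → 2 * E + 6 + suc m * (t + s)) (+-comm m 2)))
  -- The deficit 3 exceeds the permitted 2 by one: 4n ≤ 2E + 9 is improved to 2n ≤ E + 4.
  by-cases zero zero _ (inj₂ bound) = begin
    4 * n            ≡⟨ *-assoc 2 2 n ⟩
    2 * (2 * n)      ≤⟨ *-monoʳ-≤ 2 (halve (2 * n) (E + 4) (begin
      2 * (2 * n)      ≡⟨ *-assoc 2 2 n ⟨
      4 * n            ≤⟨ total 0 bound ⟩
      2 * E + 6 + 3    ≡⟨ shift₁ E ⟩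
      2 * (E + 4) + 1  ∎)) ⟩
    2 * (E + 4)      ≡⟨ shift₂ E ⟩
    2 * E + 6 + 2    ∎
    where
    shift₁ : ∀ E → 2 * E + 6 + 3 ≡ 2 * (E + 4) + 1
    shift₁ = solve-∀
    shift₂ : ∀ E → 2 * (E + 4) ≡ 2 * E + 6 + 2
    shift₂ = solve-∀
  by-cases zero (suc s) () (inj₂ _)
  -- For positive `m` the permitted deficit is at least the actual one; the summand inserted below
  -- is their difference.
  by-cases (suc m) s _ (inj₂ bound) = ≤-trans (total (suc m) bound) (+-monoʳ-≤ (2 * E + 6) (begin
    suc m + 3 + s                            ≤⟨ m≤m+n _ _ ⟩
    suc m + 3 + s + (m + 2 + s + m * (3 + m + s))  ≡⟨ expand m s ⟩
    suc (suc m) * (suc (suc (suc m)) + s)    ∎))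
    where
    expand : ∀ m s → 1 + m + 3 + s + (m + 2 + s + m * (3 + m + s)) ≡ (2 + m) * (3 + m + s)
    expand = solve-∀

-- The inequality is doubled and its negative terms are moved across, so that it can be stated in
-- natural numbers.
theorem3p1 : (k n : ℕ) → 2 ≤ k → (r s : ℕ) → IsFloorSqrt (k ∸ 1) r → IsFloorSqrt (k ∸ 2) s →
    k + r + 2 ≤ n → (G : Graph n) → CoCritical k G →
    (k + 2) * n ≤ 2 * e G + 6 + (k ∸ 1) * (k + s)
theorem3p1 (suc (suc m)) n (s≤s (s≤s z≤n)) r s _ (s²≤m , m<[s+1]²) _ G G-cocritical
  with settle (CoCritical.simple G-cocritical) (CoCritical.critical G-cocritical)
... | c , c-critical , c-settled =
  combine m s n (e G) (sum (degree R)) (sum (degree B)) s²≤m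
    (trans (handshake (CoCritical.simple G-cocritical)) (degree-split G c))
    (saturated-bound R-saturated other)
    (LowBlueDegree.blue-bound R-simple R-c4free B m s m<[s+1]²
      λ u v du dv → low-clique u v (below du) (below dv))
  where
  open Settlement G-cocritical c-critical c-settled
  open Colouring (CoCritical.simple G-cocritical) c-critical using (R; B; R-simple; R-c4free)
  below : ∀ {d} → d ≤ m → d + 2 ≤ suc (suc m)
  below {d} d≤m = ≤-trans (≤-reflexive (+-comm d 2)) (s≤s (s≤s d≤m))
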